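{- Let $\beta>1$ be a quadratic Pisot unit whose algebraic conjugate is negative. Then every rational number $x\in I_\beta\cap(-\infty,0]$ has a purely periodic $(-\beta)$-expansion, and no rational number $x\in I_\beta\cap(0,+\infty)$ has a purely periodic $(-\beta)$-expansion.
   Context: For $\beta>1$ let $I_\beta=\left[-\frac{\beta}{\beta+1},\frac{1}{\beta+1}\right)$ and define $T_{ -\beta}:I_\beta\to I_\beta$ by $T_{ -\beta}(x)=-\beta x-\left\lfloor -\beta x+\frac{\beta}{\beta+1}\right\rfloor$. For $x\in I_\beta$ put $x_i=\left\lfloor -\beta T_{ -\beta}^{i-1}(x)+\frac{\beta}{\beta+1}\right\rfloor\in\{0,1,\dots,\lfloor\beta\rfloor\}$; then $x=\sum_{i\ge1}x_i(-\beta)^{ -i}$, and $d_{ -\beta}(x):=x_1x_2x_3\cdots$ is the $(-\beta)$-expansion of $x$. It is purely periodic if $d_{ -\beta}(x)=(a_1\cdots a_N)^\omega$ for some finite word $a_1\cdots a_N$. -}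

module Defs where

-- Exact arithmetic and order in the real quadratic field Q(sqrt D),
-- which is enough to express the (-beta)-transformation of a quadratic
-- beta on rational (indeed on Q(beta)) points.

open import Data.Nat as ℕ using (ℕ; suc; _≤_)
open import Data.Integer as ℤ using (ℤ; +_)
open import Data.Rational as ℚ using (ℚ; 0ℚ; 1ℚ; _/_; _≟_; 1/_; ≢-nonZero)
open import Data.Product using (_×_; Σ; ∃)
open import Data.Sum using (_⊎_)
open import Relation.Nullary using (yes; no)
open import Relation.Binary.PropositionalEquality using (_≡_)

-- r ⊕ s √ stands for the real number r + s·√D
record QF : Set where
  constructor _⊕_√
  field
    re : ℚ
    im : ℚ
open QF public

module Field (D : ℕ) where

  Dq : ℚ
  Dq = (+ D) / 1

  infixl 6 _+F_ _-F_
  infixl 7 _*F_ _/F_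
  infix 4 _<F_ _≤F_

  ι : ℚ → QF
  ι x = x ⊕ 0ℚ √

  ιℤ : ℤ → QF
  ιℤ n = ι (n / 1)

  _+F_ : QF → QF → QF
  (a ⊕ b √) +F (c ⊕ d √) = (a ℚ.+ c) ⊕ (b ℚ.+ d) √

  -F_ : QF → QF
  -F (a ⊕ b √) = (ℚ.- a) ⊕ (ℚ.- b) √

  _-F_ : QF → QF → QF
  x -F y = x +F (-F y)

  _*F_ : QF → QF → QF
  (a ⊕ b √) *F (c ⊕ d √) =
    (a ℚ.* c ℚ.+ b ℚ.* d ℚ.* Dq) ⊕ (a ℚ.* d ℚ.+ b ℚ.* c) √

  -- multiplicative inverse (a - b√D)/(a² - b²D); junk value 0 at 0
  -- (for non-square D the norm vanishes only at 0)
  invF : QF → QF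
  invF (a ⊕ b √) with a ℚ.* a ℚ.- b ℚ.* b ℚ.* Dq ≟ 0ℚ
  ... | yes _ = 0ℚ ⊕ 0ℚ √
  ... | no N≢0 = (a ℚ.* n) ⊕ (ℚ.- b ℚ.* n) √
    where
      n : ℚ
      n = (1/ (a ℚ.* a ℚ.- b ℚ.* b ℚ.* Dq)) {{≢-nonZero N≢0}}

  _/F_ : QF → QF → QF
  x /F y = x *F invF y

  -- a + b√D > 0 as a real number (√D the positive square root)
  PosF : QF → Set
  PosF (a ⊕ b √) =
      (0ℚ ℚ.< a × 0ℚ ℚ.≤ b)
    ⊎ (0ℚ ℚ.≤ a × 0ℚ ℚ.< b)
    ⊎ (0ℚ ℚ.< a × b ℚ.< 0ℚ × b ℚ.* b ℚ.* Dq ℚ.< a ℚ.* a)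
    ⊎ (a ℚ.< 0ℚ × 0ℚ ℚ.< b × a ℚ.* a ℚ.< b ℚ.* b ℚ.* Dq)

  _<F_ : QF → QF → Set
  x <F y = PosF (y -F x)

  _≤F_ : QF → QF → Set
  x ≤F y = x <F y ⊎ x ≡ y

  1F : QF
  1F = ι 1ℚ

  -- beta = (p + √D)/2, the larger root of X² - pX - q when D = p² + 4q
  β : ℤ → QF
  β p = (p / 2) ⊕ (1ℚ ℚ.* ((+ 1) / 2)) √

  β' : ℤ → QF
  β' p = (p / 2) ⊕ ((ℤ.- (+ 1)) / 2) √

  InI : ℤ → QF → Set
  InI p x = (-F (β p /F (β p +F 1F))) ≤F x × x <F (1F /F (β p +F 1F))

  IsFloor : QF → ℤ → Set
  IsFloor y n = ιℤ n ≤F y × y <F ιℤ (n ℤ.+ + 1)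

  -- t is the T_{-β}-orbit of x and d its digit sequence:
  -- t 0 = x,  d i = ⌊ -β t_i + β/(β+1) ⌋,  t (i+1) = -β t_i - d i
  -- (indices shifted by one relative to x_i in the paper: d i = x_{i+1})
  IsExpansion : ℤ → QF → (ℕ → ℤ) → (ℕ → QF) → Set
  IsExpansion p x d t =
      t 0 ≡ x
    × (∀ i → IsFloor ((-F (β p *F t i)) +F (β p /F (β p +F 1F))) (d i))
    × (∀ i → t (suc i) ≡ (-F (β p *F t i)) -F ιℤ (d i))

  PurelyPeriodic : (ℕ → ℤ) → Set
  PurelyPeriodic d = Σ ℕ λ N → 1 ≤ N × (∀ i → d (i ℕ.+ N) ≡ d i)

  HasPurelyPeriodicExpansion : ℤ → QF → Set
  HasPurelyPeriodicExpansion p x =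
    Σ (ℕ → ℤ) λ d → Σ (ℕ → QF) λ t → IsExpansion p x d t × PurelyPeriodic d

-- The sign hypotheses force q = 1, so γ := -β′ = 1/β lies in (0,1), p = β - γ, and the digits are 0, …, p.
-- Conjugation turns the step t ↦ -βt - d into t′ ↦ γt′ - d.  The set of all t in I with t′ ∈ [-β-1, 0], and
-- moreover t′ ≥ -β whenever t exceeds the fixed point (1-p)/(β+1), is mapped into itself, injectively; it
-- contains every rational x ≤ 0 of I.  An orbit starting at a rational with denominator m stays in (1/m)ℤ[β] with
-- bounded t and t′, hence takes a value twice, and injectivity makes it purely periodic.
-- Conversely, pure periodicity gives t_n = t_0 = x for some n ≥ 1; but if x = x′ > 0, then since the digits are
-- nonnegative and γ < 1, all later conjugates t_n′ are smaller than x.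

module Submission where

open import Defs
open import Data.Nat as ℕ using (ℕ; zero; suc)
import Data.Nat.Properties as ℕ
open import Data.Nat.Divisibility using (_∣_; divides; ∣-refl)
open import Data.Nat.Coprimality using (Coprime; coprime-divisor)
import Data.Nat.Coprimality as Coprimality
open import Data.Integer as ℤ using (ℤ; -[1+_]; 0ℤ; 1ℤ)
import Data.Integer.Properties as ℤ
open import Data.Rational as ℚ using (ℚ; 0ℚ; 1ℚ; ½; mkℚ)
import Data.Rational.Properties as ℚ
import Data.Rational.Unnormalised as ℚᵘ
import Data.Rational.Unnormalised.Properties as ℚᵘ
open import Data.Fin as Fin using (Fin)
import Data.Fin.Properties as Fin
open import Data.Maybe using (just; nothing)
open import Data.Product using (_×_; _,_; proj₁; proj₂; Σ; ∃₂)
open import Data.Sum using (_⊎_; inj₁; inj₂)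
import Data.Sum as Sum
open import Data.Empty using (⊥; ⊥-elim)
open import Level using (0ℓ)
open import Relation.Nullary using (¬_; yes; no)
open import Relation.Binary.Definitions using (tri<; tri≈; tri>)
open import Relation.Binary.PropositionalEquality
open import Algebra.Bundles using (CommutativeRing)
open import Algebra.Structures using (IsCommutativeRing)
import Algebra.Properties.AbelianGroup ℤ.+-0-abelianGroup as ℤ-group
import Algebra.Properties.Ring
import Algebra.Solver.Ring
import Algebra.Solver.Ring.AlmostCommutativeRing as ACR
open import Tactic.RingSolver.Core.AlmostCommutativeRing using (AlmostCommutativeRing; fromCommutativeRing)
open import Tactic.RingSolver using (solve-∀)

-- The strip t′ ∈ [-β-1, 0] alone is forward invariant, but the step is not injective on it: points
-- with digits e and e + 1 can share an image when the conjugate of the first lies below -β. The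
-- extra lower bound excludes such pairs. It survives the dynamics because the fixed point
-- (1-p)/(β+1) is also the image of the left endpoint -βu. For the converse, t_n = t_0 would usually
-- come from the convergence of the expansion. Here it is obtained without limits: the points at
-- multiples of the period again lie in a finite set, and a coincidence among them is pulled back
-- along equal digits. The dynamics is carried out over an abstract ring, where β, γ and u are
-- symbols subject to βγ = 1 and (β+1)u = 1. Each estimate then becomes a ring identity that writes
-- a difference as a sum of products of elements of known sign. The concrete order on Q(√D) only has
-- to satisfy the axioms.

-- Here β′ = -γ = -1/β, and u = 1/(β+1), so that the interval I is [-βu, u).
record OrderedQuadraticRing : Set₁ where
  infixl 6 _+_
  infixl 7 _*_
  infix 8 -_
  field
    K       : Set
    _+_ _*_ : K → K → K
    -_      : K → K
    ι       : ℤ → K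
    isCommutativeRing : IsCommutativeRing _≡_ _+_ _*_ -_ (ι 0ℤ) (ι 1ℤ)
    ι-+     : ∀ m n → ι (m ℤ.+ n) ≡ ι m + ι n
    ι-*     : ∀ m n → ι (m ℤ.* n) ≡ ι m * ι n
    ι-neg   : ∀ n → ι (ℤ.- n) ≡ - ι n
    Pos     : K → Set
    Pos-1   : Pos (ι 1ℤ)
    Pos-+   : ∀ {x y} → Pos x → Pos y → Pos (x + y)
    Pos-*   : ∀ {x y} → Pos x → Pos y → Pos (x * y)
    Pos-cmp : ∀ x → Pos x ⊎ x ≡ ι 0ℤ ⊎ Pos (- x)
    ¬Pos-0  : ¬ Pos (ι 0ℤ)
    conj    : K → K
    conj-+  : ∀ x y → conj (x + y) ≡ conj x + conj y
    conj-*  : ∀ x y → conj (x * y) ≡ conj x * conj y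
    conj-neg : ∀ x → conj (- x) ≡ - conj x
    conj-involutive : ∀ x → conj (conj x) ≡ x
    conj-ι  : ∀ n → conj (ι n) ≡ ι n
    β γ u   : K
    p       : ℤ
    conj-β  : conj β ≡ - γ
    ι-p     : ι p ≡ β + - γ
    βγ≡1    : β * γ ≡ ι 1ℤ
    u-inv   : (β + ι 1ℤ) * u ≡ ι 1ℤ
    Pos-γ   : Pos γ
    Pos-1-γ : Pos (ι 1ℤ + - γ)

-- Consequences of the order axioms

module Dynamics (R : OrderedQuadraticRing) where

  open OrderedQuadraticRing R

  private
    commutativeRing : CommutativeRing _ _
    commutativeRing = record { isCommutativeRing = isCommutativeRing }

    almostRing : ACR.AlmostCommutativeRing _ _
    almostRing = ACR.fromCommutativeRing commutativeRing

    integerCoefficients : CommutativeRing.rawRing ℤ.+-*-commutativeRing ACR.-Raw-AlmostCommutative⟶ almostRing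
    integerCoefficients = record
      { ⟦_⟧ = ι ; +-homo = ι-+ ; *-homo = ι-* ; -‿homo = ι-neg ; 0-homo = refl ; 1-homo = refl }

    sameCoefficient : ∀ m n → _
    sameCoefficient m n with m ℤ.≟ n
    ... | yes eq = just (cong ι eq)
    ... | no _   = nothing

  open Algebra.Solver.Ring (CommutativeRing.rawRing ℤ.+-*-commutativeRing) almostRing integerCoefficients sameCoefficient
    using (solve; _:=_; _:+_; _:*_; _:-_; :-_; con; Polynomial)
  open IsCommutativeRing isCommutativeRing
    using (+-identityʳ; +-identityˡ; zeroˡ; zeroʳ; +-comm; -‿inverseʳ; *-comm; *-identityˡ)

  one : ∀ {n} → Polynomial n
  one = con 1ℤ

  NonNeg : K → Set
  NonNeg x = Pos x ⊎ x ≡ ι 0ℤ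

  -- An identity x = y that holds only modulo a relation e = 0 becomes a ring identity x + e k = y.
  modulo : ∀ {x y e} k → e ≡ ι 0ℤ → x + e * k ≡ y → x ≡ y
  modulo {x} k refl eq = trans (sym (trans (cong (λ z → x + z) (zeroˡ k)) (+-identityʳ x))) eq

  Pos-asym : ∀ {x} → Pos x → ¬ NonNeg (- x)
  Pos-asym {x} px (inj₁ pnx) = ¬Pos-0 (subst Pos (-‿inverseʳ x) (Pos-+ px pnx))
  Pos-asym {x} px (inj₂ eq)  = ¬Pos-0 (subst Pos (trans (sym (+-identityʳ x)) (trans (cong (λ z → x + z) (sym eq)) (-‿inverseʳ x))) px)

  Pos-NonNeg-+ : ∀ {x y} → Pos x → NonNeg y → Pos (x + y)
  Pos-NonNeg-+ px (inj₁ py)       = Pos-+ px py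
  Pos-NonNeg-+ {x} px (inj₂ refl) = subst Pos (sym (+-identityʳ x)) px

  NonNeg-+ : ∀ {x y} → NonNeg x → NonNeg y → NonNeg (x + y)
  NonNeg-+ (inj₁ px) ny       = inj₁ (Pos-NonNeg-+ px ny)
  NonNeg-+ {y = y} (inj₂ refl) ny = subst NonNeg (sym (+-identityˡ y)) ny

  NonNeg-* : ∀ {x y} → NonNeg x → NonNeg y → NonNeg (x * y)
  NonNeg-* (inj₁ px) (inj₁ py)        = inj₁ (Pos-* px py)
  NonNeg-* {x} _ (inj₂ refl)          = inj₂ (zeroʳ x)
  NonNeg-* {y = y} (inj₂ refl) _      = inj₂ (zeroˡ y)

  neg-zero : - ι 0ℤ ≡ ι 0ℤ
  neg-zero = sym (ι-neg 0ℤ)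

  NonNeg-or-neg : ∀ x → NonNeg x ⊎ Pos (- x)
  NonNeg-or-neg x with Pos-cmp x
  ... | inj₁ px        = inj₁ (inj₁ px)
  ... | inj₂ (inj₁ eq) = inj₁ (inj₂ eq)
  ... | inj₂ (inj₂ pn) = inj₂ pn

  Pos-or-neg : ∀ x → Pos x ⊎ NonNeg (- x)
  Pos-or-neg x with Pos-cmp x
  ... | inj₁ px        = inj₁ px
  ... | inj₂ (inj₁ eq) = inj₂ (inj₂ (trans (cong -_ eq) neg-zero))
  ... | inj₂ (inj₂ pn) = inj₂ (inj₁ pn)

  Pos-cancel : ∀ {x c} → Pos c → Pos (x * c) → Pos x
  Pos-cancel {x} {c} pc pxc with Pos-or-neg x
  ... | inj₁ px = px
  ... | inj₂ nx = ⊥-elim (Pos-asym pxc (subst NonNeg (solve 2 (λ x c → (:- x) :* c := :- (x :* c)) refl x c) (NonNeg-* nx (inj₁ pc))))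

  NonNeg-cancel : ∀ {x c} → Pos c → NonNeg (x * c) → NonNeg x
  NonNeg-cancel {x} {c} pc nxc with NonNeg-or-neg x
  ... | inj₁ nx = nx
  ... | inj₂ px = ⊥-elim (Pos-asym (Pos-* px pc) (subst NonNeg (solve 2 (λ x c → x :* c := :- ((:- x) :* c)) refl x c) nxc))

  -- The ring is not assumed to be a field; instead, either strict sign of x - y would make (x - y)c
  -- = 0 or its negative positive.
  *-cancelʳ : ∀ {x y} c → Pos c → x * c ≡ y * c → x ≡ y
  *-cancelʳ {x} {y} c pc eq with Pos-cmp (x + - y)
  ... | inj₁ h = ⊥-elim (¬Pos-0 (subst Pos (trans (solve 3 (λ x y c → (x :- y) :* c := x :* c :- y :* c) refl x y c)
                                   (trans (cong (_+ - (y * c)) eq) (-‿inverseʳ _))) (Pos-* h pc)))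
  ... | inj₂ (inj₁ h) = trans (solve 2 (λ x y → x := (x :- y) :+ y) refl x y) (trans (cong (_+ y) h) (+-identityˡ y))
  ... | inj₂ (inj₂ h) = ⊥-elim (¬Pos-0 (subst Pos (trans (solve 3 (λ x y c → (:- (x :- y)) :* c := y :* c :- x :* c) refl x y c)
                                   (trans (cong (λ z → y * c + - z) eq) (-‿inverseʳ _))) (Pos-* h pc)))

  ι-− : ∀ m n → ι (m ℤ.- n) ≡ ι m + - ι n
  ι-− m n = trans (ι-+ m (ℤ.- n)) (cong (ι m +_) (ι-neg n))

  Pos-ι-suc : ∀ n → Pos (ι (ℤ.+ suc n))
  Pos-ι-suc zero    = Pos-1
  Pos-ι-suc (suc n) = subst Pos (sym (ι-+ 1ℤ (ℤ.+ suc n))) (Pos-+ Pos-1 (Pos-ι-suc n))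

  NonNeg-ι : ∀ {n} → 0ℤ ℤ.≤ n → NonNeg (ι n)
  NonNeg-ι {ℤ.+ zero}  _ = inj₂ refl
  NonNeg-ι {ℤ.+ suc n} _ = inj₁ (Pos-ι-suc n)

  Pos-ι⁻¹ : ∀ {n} → Pos (ι n) → 0ℤ ℤ.< n
  Pos-ι⁻¹ {ℤ.+ zero}    h = ⊥-elim (¬Pos-0 h)
  Pos-ι⁻¹ {ℤ.+ suc n}   _ = ℤ.+<+ (ℕ.s≤s ℕ.z≤n)
  Pos-ι⁻¹ { -[1+ n ]} h = ⊥-elim (Pos-asym h (inj₁ (subst Pos (ι-neg -[1+ n ]) (Pos-ι-suc n))))

  ι-cancel-< : ∀ {m n} → Pos (ι n + - ι m) → m ℤ.< n
  ι-cancel-< {m} {n} h = subst₂ ℤ._<_ (ℤ.+-identityˡ m)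
    (trans (ℤ.+-assoc n (ℤ.- m) m) (trans (cong (λ z → n ℤ.+ z) (ℤ.+-inverseˡ m)) (ℤ.+-identityʳ n)))
    (ℤ.+-monoˡ-< m (Pos-ι⁻¹ (subst Pos (sym (ι-− n m)) h)))

  ι-mono-≤ : ∀ {m n} → m ℤ.≤ n → NonNeg (ι n + - ι m)
  ι-mono-≤ {m} {n} m≤n = subst NonNeg (ι-− n m) (NonNeg-ι (ℤ.i≤j⇒0≤j-i m≤n))

  ι-suc : ∀ n → ι (n ℤ.+ 1ℤ) ≡ ι n + ι 1ℤ
  ι-suc n = ι-+ n 1ℤ

  ι-mono-< : ∀ {m n} → m ℤ.< n → NonNeg (ι n + - (ι m + ι 1ℤ))
  ι-mono-< {m} {n} m<n =
    subst (λ z → NonNeg (ι n + - z)) (trans (cong ι (ℤ.+-comm 1ℤ m)) (ι-suc m)) (ι-mono-≤ (ℤ.i<j⇒suc[i]≤j m<n))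

  ι-cancel-≤ : ∀ {m n} → NonNeg (ι n + - ι m) → m ℤ.≤ n
  ι-cancel-≤ {m} {n} h with m ℤ.≤? n
  ... | yes m≤n = m≤n
  ... | no m≰n  = ⊥-elim (Pos-asym (Pos-NonNeg-+ Pos-1 (ι-mono-< (ℤ.≰⇒> m≰n)))
    (subst NonNeg (solve 2 (λ m n → n :- m := :- (one :+ (m :- (n :+ one)))) refl (ι m) (ι n)) h))

  -- Discreteness of ℤ: this turns a strict estimate in the ring, such as d < p + 1, into a sharp
  -- bound d ≤ p.
  <⇒≤pred : ∀ {m n} → Pos ((ι n + ι 1ℤ) + - ι m) → m ℤ.≤ n
  <⇒≤pred {m} {n} h = subst (m ℤ.≤_) (trans (cong ℤ.pred (ℤ.+-comm n 1ℤ)) (ℤ.pred-suc n))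
    (ℤ.i<j⇒i≤pred[j] (ι-cancel-< (subst (λ z → Pos (z + - ι m)) (sym (ι-suc n)) h)))

  -- The constants β, γ and u

  private
    E : β * γ + - ι 1ℤ ≡ ι 0ℤ
    E = trans (cong (_+ - ι 1ℤ) βγ≡1) (-‿inverseʳ (ι 1ℤ))

    F : (β + ι 1ℤ) * u + - ι 1ℤ ≡ ι 0ℤ
    F = trans (cong (_+ - ι 1ℤ) u-inv) (-‿inverseʳ (ι 1ℤ))

  Pos-β : Pos β
  Pos-β = Pos-cancel Pos-γ (subst Pos (sym βγ≡1) Pos-1)

  Pos-β-1 : Pos (β + - ι 1ℤ)
  Pos-β-1 = subst Pos (modulo (ι 1ℤ) E
    (solve 2 (λ β γ → β :* (one :- γ) :+ (β :* γ :- one) :* one := β :- one) refl β γ)) (Pos-* Pos-β Pos-1-γ)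

  Pos-β+1 : Pos (β + ι 1ℤ)
  Pos-β+1 = Pos-+ Pos-β Pos-1

  Pos-u : Pos u
  Pos-u = Pos-cancel Pos-β+1 (subst Pos (trans (sym u-inv) (*-comm _ _)) Pos-1)

  -- The trace β - γ is the integer p, hence fixed by conjugation.
  conj-γ : conj γ ≡ - β
  conj-γ = begin
    conj γ                                ≡⟨ solve 2 (λ γ c → c := :- γ :- (:- γ :+ :- c)) refl γ (conj γ) ⟩
    - γ + - (- γ + - conj γ)              ≡⟨ cong (λ z → - γ + - z) conj-p ⟨
    - γ + - ι p                           ≡⟨ cong (λ z → - γ + - z) ι-p ⟩
    - γ + - (β + - γ)                     ≡⟨ solve 2 (λ β γ → :- γ :- (β :- γ) := :- β) refl β γ ⟩
    - β                                   ∎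
    where
    open ≡-Reasoning
    conj-p : ι p ≡ - γ + - conj γ
    conj-p = trans (sym (conj-ι p)) (trans (cong conj ι-p)
               (trans (conj-+ β (- γ)) (cong₂ _+_ conj-β (conj-neg γ))))

  -- The transformation, its interval and its digits

  digitArgument : K → K
  digitArgument t = - (β * t) + β * u

  record InInterval (t : K) : Set where
    constructor interval
    field
      lower : NonNeg (t + β * u)
      upper : Pos (u + - t)

  interval<1 : ∀ {t} → InInterval t → Pos (ι 1ℤ + - t)
  interval<1 {t} (interval _ upper) = subst Pos (modulo (- ι 1ℤ) F (solve 3 (λ β u t →
      ((u :- t) :+ β :* u) :+ ((β :+ one) :* u :- one) :* (:- one) := one :- t) refl β u t))
    (Pos-+ upper (Pos-* Pos-β Pos-u))

  record Digit (t : K) (d : ℤ) : Set where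
    constructor floor
    field
      below : NonNeg (digitArgument t + - ι d)
      above : Pos ((ι d + ι 1ℤ) + - digitArgument t)

  next : K → ℤ → K
  next t d = - (β * t) + - ι d

  module _ {t : K} {d : ℤ} (int : InInterval t) (dig : Digit t d) where
    open InInterval int
    open Digit dig

    -- Because 1 - βu = u, the two floor inequalities are exactly the two interval conditions on the
    -- image.
    next-interval : InInterval (next t d)
    next-interval = interval
      (subst NonNeg (solve 4 (λ β t u d → (:- (β :* t) :+ β :* u) :- d := (:- (β :* t) :- d) :+ β :* u) refl β t u (ι d)) below)
      (subst Pos (modulo (ι 1ℤ) F (solve 4 (λ β t u d →
          ((d :+ one) :- (:- (β :* t) :+ β :* u)) :+ ((β :+ one) :* u :- one) :* one := u :- (:- (β :* t) :- d)) refl β t u (ι d))) above)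

    digit-nonNeg : 0ℤ ℤ.≤ d
    digit-nonNeg = <⇒≤pred (subst Pos (solve 4 (λ β t u d →
        β :* (u :- t) :+ ((d :+ one) :- (:- (β :* t) :+ β :* u)) := (d :+ one) :- con 0ℤ) refl β t u (ι d))
      (Pos-+ (Pos-* Pos-β upper) above))

    -- From t ≥ -βu, the argument of the floor is at most β(βu) + βu = β = p + γ < p + 1.
    digit≤p : d ℤ.≤ p
    digit≤p = <⇒≤pred (subst (λ z → Pos ((z + ι 1ℤ) + - ι d)) (sym ι-p)
      (subst Pos (modulo (- β) F (solve 5 (λ β γ t u d →
          ((one :- γ) :+ (((:- (β :* t) :+ β :* u) :- d) :+ β :* (t :+ β :* u))) :+ ((β :+ one) :* u :- one) :* (:- β)
            := ((β :- γ) :+ one) :- d) refl β γ t u (ι d)))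
        (Pos-NonNeg-+ Pos-1-γ (NonNeg-+ below (NonNeg-* (inj₁ Pos-β) lower)))))

  -- The invariant domain

  -- The domain of the natural extension; (1-p)/(β+1) is a fixed point of the transformation.
  record Domain (t : K) : Set where
    constructor domain
    field
      inInterval  : InInterval t
      conj≤0      : NonNeg (- conj t)
      conj≥-β-1   : NonNeg (conj t + (β + ι 1ℤ))
      conj≥-β     : Pos ((β + ι 1ℤ) * t + ((β + - γ) + - ι 1ℤ)) → NonNeg (conj t + β)

  conj-next : ∀ t d → conj (next t d) ≡ γ * conj t + - ι d
  conj-next t d = begin
    conj (- (β * t) + - ι d)             ≡⟨ conj-+ _ _ ⟩
    conj (- (β * t)) + conj (- ι d)      ≡⟨ cong₂ _+_
                                              (trans (conj-neg _) (cong -_ (trans (conj-* β t) (cong (_* conj t) conj-β))))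
                                              (trans (conj-neg _) (cong -_ (conj-ι d))) ⟩
    - (- γ * conj t) + - ι d             ≡⟨ solve 3 (λ γ c d → :- (:- γ :* c) :- d := γ :* c :- d) refl γ (conj t) (ι d) ⟩
    γ * conj t + - ι d                   ∎
    where open ≡-Reasoning

  -- Origin of the constant: γ(-β-1) - p = -β-1, so -β-1 is the fixed point of the conjugate step
  -- with the largest digit.
  conj-next-lower : ∀ t d → d ℤ.≤ p → NonNeg (conj t + (β + ι 1ℤ)) → NonNeg (conj (next t d) + (β + ι 1ℤ))
  conj-next-lower t d d≤p h = subst (λ z → NonNeg (z + (β + ι 1ℤ))) (sym (conj-next t d))
    (subst NonNeg (modulo (- ι 1ℤ) E (solve 4 (λ β γ c d →
        (γ :* (c :+ (β :+ one)) :+ ((β :- γ) :- d)) :+ (β :* γ :- one) :* (:- one)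
          := (γ :* c :- d) :+ (β :+ one)) refl β γ (conj t) (ι d)))
      (NonNeg-+ (NonNeg-* (inj₁ Pos-γ) h) (subst (λ z → NonNeg (z + - ι d)) ι-p (ι-mono-≤ d≤p))))

  -- The branch with digit p has slope -β and sends the left endpoint -βu to (1-p)/(β+1), so it
  -- sends every point of the interval to that fixed point or below it.
  fixed-point-gap : ∀ t → (β + ι 1ℤ) * next t p + ((β + - γ) + - ι 1ℤ) ≡ - (β * (β + ι 1ℤ) * (t + β * u))
  fixed-point-gap t = trans (cong (λ z → (β + ι 1ℤ) * (- (β * t) + - z) + ((β + - γ) + - ι 1ℤ)) ι-p)
    (modulo (- ι 1ℤ) E (modulo (- (β * β)) F (solve 4 (λ β γ t u →
      (((β :+ one) :* (:- (β :* t) :- (β :- γ)) :+ ((β :- γ) :- one)) :+ (β :* γ :- one) :* (:- one))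
        :+ ((β :+ one) :* u :- one) :* (:- (β :* β)) := :- (β :* (β :+ one) :* (t :+ β :* u))) refl β γ t u)))

  next-domain : ∀ {t d} → Domain t → Digit t d → Domain (next t d)
  next-domain {t} {d} dom dig = domain (next-interval inInterval dig)
    (subst NonNeg
      (trans (solve 3 (λ γ c d → γ :* (:- c) :+ (d :- con 0ℤ) := :- (γ :* c :- d)) refl γ (conj t) (ι d)) (cong -_ (sym (conj-next t d))))
      (NonNeg-+ (NonNeg-* (inj₁ Pos-γ) conj≤0) (ι-mono-≤ (digit-nonNeg inInterval dig))))
    (conj-next-lower t d d≤p conj≥-β-1)
    conj-next≥-β
    where
    open Domain dom
    d≤p = digit≤p inInterval dig
    conj-next≥-β : Pos ((β + ι 1ℤ) * next t d + ((β + - γ) + - ι 1ℤ)) → NonNeg (conj (next t d) + β)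
    conj-next≥-β h with d ℤ.≟ p
    -- Here d ≤ p - 1, and γ(-β-1) - (p-1) = -β.
    ... | no d≢p = subst (λ z → NonNeg (z + β)) (sym (conj-next t d))
      (subst NonNeg (modulo (- ι 1ℤ) E (solve 4 (λ β γ c d →
          (γ :* (c :+ (β :+ one)) :+ ((β :- γ) :- (d :+ one))) :+ (β :* γ :- one) :* (:- one)
            := (γ :* c :- d) :+ β) refl β γ (conj t) (ι d)))
        (NonNeg-+ (NonNeg-* (inj₁ Pos-γ) conj≥-β-1)
          (subst (λ z → NonNeg (z + - (ι d + ι 1ℤ))) ι-p (ι-mono-< (ℤ.≤∧≢⇒< d≤p d≢p)))))
    ... | yes refl = ⊥-elim (Pos-asym h (subst NonNeg
        (trans (solve 1 (λ x → x := :- (:- x)) refl _) (cong -_ (sym (fixed-point-gap t))))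
        (NonNeg-* (inj₁ (Pos-* Pos-β Pos-β+1)) (InInterval.lower inInterval))))

  -- Injectivity of the step on the domain

  conj≡0⇒≡0 : ∀ {x} → conj x ≡ ι 0ℤ → x ≡ ι 0ℤ
  conj≡0⇒≡0 {x} eq = trans (sym (conj-involutive x)) (trans (cong conj eq) (conj-ι 0ℤ))

  neg-cancel : ∀ {x} → - x ≡ ι 0ℤ → x ≡ ι 0ℤ
  neg-cancel {x} eq = trans (solve 1 (λ x → x := :- (:- x)) refl x) (trans (cong -_ eq) neg-zero)

  digit-of-zero : ∀ {d} → Digit (ι 0ℤ) d → ¬ (0ℤ ℤ.< d)
  digit-of-zero {d} (floor below _) 0<d = Pos-asym Pos-u
    (subst NonNeg (modulo (- ι 1ℤ) F (solve 3 (λ β u d →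
        (((:- (β :* con 0ℤ) :+ β :* u) :- d) :+ (d :- (con 0ℤ :+ one))) :+ ((β :+ one) :* u :- one) :* (:- one) := :- u) refl β u (ι d)))
      (NonNeg-+ below (ι-mono-< 0<d)))

  -- Equal images force s′ = t′ - β(d - e) < -β, so s lies at or below the fixed point and its digit
  -- is at least p - 1; thus e = p - 1 and d = p. The images then lie on opposite sides of the fixed
  -- point, in the weak sense, so s is the fixed point itself. But the conjugate of that point is
  -- above -β.
  module Collision {s t : K} {e d : ℤ} (dom-s : Domain s) (dom-t : Domain t)
                   (dig-s : Digit s e) (dig-t : Digit t d) (next≡ : next s e ≡ next t d) (e<d : e ℤ.< d) where
    module S = Domain dom-s
    module T = Domain dom-t

    d≤p : d ℤ.≤ p
    d≤p = digit≤p T.inInterval dig-t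

    X : K
    X = (β + ι 1ℤ) * s + ((β + - γ) + - ι 1ℤ)

    conj-t<0 : Pos (- conj t)
    conj-t<0 with T.conj≤0
    ... | inj₁ h  = h
    -- If t′ = 0 then t = 0, whose digit is not positive since βu < 1; but d > e ≥ 0.
    ... | inj₂ eq = ⊥-elim (digit-of-zero (subst (λ z → Digit z d) (conj≡0⇒≡0 (neg-cancel eq)) dig-t)
                      (ℤ.≤-<-trans (digit-nonNeg S.inInterval dig-s) e<d))

    conj-next≡ : (γ * conj s + - ι e) + - (γ * conj t + - ι d) ≡ ι 0ℤ
    conj-next≡ = trans
      (cong (_+ - (γ * conj t + - ι d)) (trans (sym (conj-next s e)) (trans (cong conj next≡) (conj-next t d))))
      (-‿inverseʳ _)

    conj-s<-β : Pos (- (conj s + β))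
    conj-s<-β = subst Pos (modulo (- β) conj-next≡ (modulo (conj s + - conj t) E (solve 6 (λ β γ s t e d →
        ((:- t :+ β :* (d :- (e :+ one))) :+ ((γ :* s :- e) :- (γ :* t :- d)) :* (:- β)) :+ (β :* γ :- one) :* (s :- t) := :- (s :+ β))
        refl β γ (conj s) (conj t) (ι e) (ι d))))
      (Pos-NonNeg-+ conj-t<0 (NonNeg-* (inj₁ Pos-β) (ι-mono-< e<d)))

    X≤0 : NonNeg (- X)
    X≤0 with Pos-or-neg X
    ... | inj₁ h = ⊥-elim (Pos-asym conj-s<-β (subst NonNeg (solve 1 (λ x → x := :- (:- x)) refl _) (S.conj≥-β h)))
    ... | inj₂ h = h

    -- For s at or below the fixed point, -βs + βu ≥ β(p-1)u + βu = p - pu, and pu < 1; hence e + 1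
    -- > p - 1.
    p≤e+1 : p ℤ.≤ e ℤ.+ 1ℤ
    p≤e+1 = <⇒≤pred (subst₂ (λ v w → Pos ((v + ι 1ℤ) + - w)) (sym (ι-suc e)) (sym ι-p)
      (Pos-cancel Pos-β+1 (subst Pos (modulo β F (solve 5 (λ β γ u s e →
          ((γ :+ one) :+ ((β :+ one) :* ((e :+ one) :- (:- (β :* s) :+ β :* u))
                          :+ β :* (:- ((β :+ one) :* s :+ ((β :- γ) :- one)))))
            :+ ((β :+ one) :* u :- one) :* β
            := (((e :+ one) :+ one) :- (β :- γ)) :* (β :+ one)) refl β γ u s (ι e)))
        (Pos-NonNeg-+ (Pos-+ Pos-γ Pos-1) (NonNeg-+ (NonNeg-* (inj₁ Pos-β+1) (inj₁ (Digit.above dig-s))) (NonNeg-* (inj₁ Pos-β) X≤0))))))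

    e+1≤d : e ℤ.+ 1ℤ ℤ.≤ d
    e+1≤d = subst (ℤ._≤ d) (ℤ.+-comm 1ℤ e) (ℤ.i<j⇒suc[i]≤j e<d)

    d≡p : d ≡ p
    d≡p = ℤ.≤-antisym d≤p (ℤ.≤-trans p≤e+1 e+1≤d)

    ι-e : ι e ≡ (β + - γ) + - ι 1ℤ
    ι-e = trans (solve 1 (λ e → e := (e :+ one) :- one) refl (ι e))
      (cong (_+ - ι 1ℤ) (trans (sym (ι-suc e)) (trans (cong ι (ℤ.≤-antisym (ℤ.≤-trans e+1≤d d≤p) p≤e+1)) ι-p)))

    p-1 : K
    p-1 = (β + - γ) + - ι 1ℤ

    -- The branch with digit p - 1 fixes the fixed point and swaps its sides, while the branch with
    -- digit p lands at or below it. The left side is therefore nonnegative and the right side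
    -- nonpositive.
    gaps : β * (- X) ≡ - (β * (β + ι 1ℤ) * (t + β * u))
    gaps = begin
      β * (- X)
        ≡⟨ solve 3 (λ β γ s → β :* (:- ((β :+ one) :* s :+ ((β :- γ) :- one)))
             := (β :+ one) :* (:- (β :* s) :- ((β :- γ) :- one)) :+ ((β :- γ) :- one)) refl β γ s ⟩
      (β + ι 1ℤ) * (- (β * s) + - p-1) + p-1    ≡⟨ cong (λ z → (β + ι 1ℤ) * (- (β * s) + - z) + p-1) ι-e ⟨
      (β + ι 1ℤ) * next s e + p-1               ≡⟨ cong (λ z → (β + ι 1ℤ) * z + p-1) next≡ ⟩
      (β + ι 1ℤ) * next t d + p-1               ≡⟨ cong (λ z → (β + ι 1ℤ) * next t z + p-1) d≡p ⟩
      (β + ι 1ℤ) * next t p + p-1               ≡⟨ fixed-point-gap t ⟩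
      - (β * (β + ι 1ℤ) * (t + β * u))          ∎
      where open ≡-Reasoning

    X≡0 : X ≡ ι 0ℤ
    X≡0 with X≤0
    ... | inj₂ eq = neg-cancel eq
    ... | inj₁ h  = ⊥-elim (Pos-asym (subst Pos gaps (Pos-* Pos-β h))
        (subst NonNeg (solve 1 (λ x → x := :- (:- x)) refl _) (NonNeg-* (inj₁ (Pos-* Pos-β Pos-β+1)) (InInterval.lower T.inInterval))))

    conj-X≡0 : (- γ + ι 1ℤ) * conj s + ((- γ + β) + - ι 1ℤ) ≡ ι 0ℤ
    conj-X≡0 = begin
      (- γ + ι 1ℤ) * conj s + ((- γ + β) + - ι 1ℤ)  ≡⟨ cong₂ _+_ (cong (_* conj s) conj-β+1) conj-p-1 ⟨
      conj (β + ι 1ℤ) * conj s + conj ((β + - γ) + - ι 1ℤ) ≡⟨ cong (_+ conj ((β + - γ) + - ι 1ℤ)) (conj-* _ _) ⟨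
      conj ((β + ι 1ℤ) * s) + conj ((β + - γ) + - ι 1ℤ) ≡⟨ conj-+ _ _ ⟨
      conj X                                       ≡⟨ cong conj X≡0 ⟩
      conj (ι 0ℤ)                                  ≡⟨ conj-ι 0ℤ ⟩
      ι 0ℤ                                         ∎
      where
      open ≡-Reasoning
      conj-β+1 : conj (β + ι 1ℤ) ≡ - γ + ι 1ℤ
      conj-β+1 = trans (conj-+ _ _) (cong₂ _+_ conj-β (conj-ι 1ℤ))
      conj-p-1 : conj ((β + - γ) + - ι 1ℤ) ≡ (- γ + β) + - ι 1ℤ
      conj-p-1 = trans (conj-+ _ _) (cong₂ _+_
        (trans (conj-+ _ _) (cong₂ _+_ conj-β (trans (conj-neg γ) (trans (cong -_ conj-γ) (solve 1 (λ β → :- (:- β) := β) refl β)))))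
        (trans (conj-neg _) (cong -_ (conj-ι 1ℤ))))

    -- Solving the conjugate equation gives s′ = -β + γ/(1-γ), which contradicts s′ < -β.
    impossible : ⊥
    impossible = ¬Pos-0 (subst Pos (modulo (- ι 1ℤ) E (modulo (ι 1ℤ) conj-X≡0 (solve 3 (λ β γ s →
        (((one :- γ) :* (:- (s :+ β)) :+ γ) :+ (β :* γ :- one) :* (:- one))
          :+ ((:- γ :+ one) :* s :+ ((:- γ :+ β) :- one)) :* one := con 0ℤ)
        refl β γ (conj s))))
      (Pos-+ (Pos-* Pos-1-γ conj-s<-β) Pos-γ))

  next-cancel : ∀ {s t d} → next s d ≡ next t d → s ≡ t
  next-cancel {s} {t} {d} eq = *-cancelʳ β Pos-β (begin
    s * β                    ≡⟨ solve 3 (λ β s d → s :* β := :- ((:- (β :* s) :- d) :+ d)) refl β s (ι d) ⟩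
    - (next s d + ι d)       ≡⟨ cong (λ z → - (z + ι d)) eq ⟩
    - (next t d + ι d)       ≡⟨ solve 3 (λ β t d → t :* β := :- ((:- (β :* t) :- d) :+ d)) refl β t (ι d) ⟨
    t * β                    ∎)
    where open ≡-Reasoning

  next-injective : ∀ {s t e d} → Domain s → Domain t → Digit s e → Digit t d → next s e ≡ next t d → s ≡ t
  next-injective {e = e} {d = d} dom-s dom-t dig-s dig-t eq with ℤ.<-cmp e d
  ... | tri< e<d _ _  = ⊥-elim (Collision.impossible dom-s dom-t dig-s dig-t eq e<d)
  ... | tri≈ _ refl _ = next-cancel eq
  ... | tri> _ _ d<e  = ⊥-elim (Collision.impossible dom-t dom-s dig-t dig-s (sym eq) d<e)

  -- Finiteness of the lattice points with bounded conjugates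

  record Lattice (m : ℤ) (z : K) : Set where
    constructor lattice
    field
      A B    : ℤ
      coords : ι m * z ≡ ι A + ι B * β

  -- By β² = pβ + 1, multiplication by -β takes A + Bβ to -B - (A + pB)β.
  next-lattice : ∀ {m z} d → Lattice m z → Lattice m (next z d)
  next-lattice {m} {z} d (lattice A B coords) = lattice (ℤ.- B ℤ.- m ℤ.* d) (ℤ.- A ℤ.- p ℤ.* B) (begin
    ι m * (- (β * z) + - ι d)
      ≡⟨ modulo β coords-0 (modulo (ι B) E (solve 7 (λ β γ m z d A B →
           (m :* (:- (β :* z) :- d) :+ (m :* z :- (A :+ B :* β)) :* β) :+ (β :* γ :- one) :* B
             := (:- B :- m :* d) :+ (:- A :- (β :- γ) :* B) :* β) refl β γ (ι m) z (ι d) (ι A) (ι B))) ⟩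
    (- ι B + - (ι m * ι d)) + (- ι A + - ((β + - γ) * ι B)) * β
      ≡⟨ cong (λ v → (- ι B + - (ι m * ι d)) + (- ι A + - (v * ι B)) * β) ι-p ⟨
    (- ι B + - (ι m * ι d)) + (- ι A + - (ι p * ι B)) * β
      ≡⟨ cong₂ (λ v w → v + w * β) (ι-neg-sub B m d) (ι-neg-sub A p B) ⟨
    ι (ℤ.- B ℤ.- m ℤ.* d) + ι (ℤ.- A ℤ.- p ℤ.* B) * β ∎)
    where
    open ≡-Reasoning
    coords-0 : ι m * z + - (ι A + ι B * β) ≡ ι 0ℤ
    coords-0 = trans (cong (_+ - (ι A + ι B * β)) coords) (-‿inverseʳ _)
    ι-neg-sub : ∀ a b c → ι (ℤ.- a ℤ.- b ℤ.* c) ≡ - ι a + - (ι b * ι c)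
    ι-neg-sub a b c = trans (ι-− (ℤ.- a) (b ℤ.* c)) (cong₂ (λ v w → v + - w) (ι-neg a) (ι-* b c))

  -- The upper bound is 1 instead of 0 so that orbits of positive rationals, which start outside
  -- `Domain`, are covered too.
  record Bounded (z : K) : Set where
    constructor bounded
    field
      inInterval : InInterval z
      conj≤1     : NonNeg (ι 1ℤ + - conj z)
      conj≥-β-1  : NonNeg (conj z + (β + ι 1ℤ))

  -- Together with the conjugate equation mz′ = A - Bγ, Cramer's rule with determinant β - β′ = β +
  -- γ gives (β+γ)B = m(z - z′) and (β+γ)A = m(γz + βz′).
  module Coordinates {m : ℤ} (0<m : Pos (ι m)) {z : K} (lat : Lattice m z) (bdd : Bounded z) where
    open Lattice lat
    open Bounded bdd
    open InInterval inInterval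

    -- One bound for all four estimates. The most demanding is γz + βz′ ≥ -γ - β(β+1), and
    -- (β+γ)(p+3) exceeds β(β+1) + γ by 2β + 2γ - γ².
    bound : ℤ
    bound = m ℤ.* (p ℤ.+ ℤ.+ 3)

    private
      z′ : K
      z′ = conj z

      L : ι m * z + - (ι A + ι B * β) ≡ ι 0ℤ
      L = trans (cong (_+ - (ι A + ι B * β)) coords) (-‿inverseʳ _)

      conj-coords : ι m * z′ ≡ ι A + ι B * - γ
      conj-coords = begin
        ι m * conj z              ≡⟨ cong (_* conj z) (conj-ι m) ⟨
        conj (ι m) * conj z       ≡⟨ conj-* _ _ ⟨
        conj (ι m * z)            ≡⟨ cong conj coords ⟩
        conj (ι A + ι B * β)      ≡⟨ conj-+ _ _ ⟩
        conj (ι A) + conj (ι B * β) ≡⟨ cong₂ _+_ (conj-ι A) (trans (conj-* _ _) (cong₂ _*_ (conj-ι B) conj-β)) ⟩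
        ι A + ι B * - γ           ∎
        where open ≡-Reasoning

      L′ : ι m * z′ + - (ι A + ι B * - γ) ≡ ι 0ℤ
      L′ = trans (cong (_+ - (ι A + ι B * - γ)) conj-coords) (-‿inverseʳ _)

      ι-bound : ι bound ≡ ι m * ((β + - γ) + ι (ℤ.+ 3))
      ι-bound = trans (ι-* m _) (cong (ι m *_) (trans (ι-+ p (ℤ.+ 3)) (cong (_+ ι (ℤ.+ 3)) ι-p)))

      1-z : NonNeg (ι 1ℤ + - z)
      1-z = inj₁ (interval<1 inInterval)

      z+1 : NonNeg (z + ι 1ℤ)
      z+1 = subst NonNeg (modulo (- ι 1ℤ) F (solve 3 (λ β u z →
          ((z :+ β :* u) :+ u) :+ ((β :+ one) :* u :- one) :* (:- one) := z :+ one) refl β u z)) (NonNeg-+ lower (inj₁ Pos-u))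

      Pos-β+γ : Pos (β + γ)
      Pos-β+γ = Pos-+ Pos-β Pos-γ

      -- This is (β+γ)p, with p split as (β-1) + (1-γ) to make its positivity visible.
      slack : Pos ((β + γ) * ((β + - ι 1ℤ) + (ι 1ℤ + - γ)))
      slack = Pos-* Pos-β+γ (Pos-+ Pos-β-1 Pos-1-γ)

      Pos-2β-2 : Pos ((β + - ι 1ℤ) + (β + - ι 1ℤ))
      Pos-2β-2 = Pos-+ Pos-β-1 Pos-β-1

      scale : ∀ {w n} → NonNeg w → ι m * w ≡ n * (β + γ) → NonNeg n
      scale nw eq = NonNeg-cancel Pos-β+γ (subst NonNeg eq (NonNeg-* (inj₁ 0<m) nw))

    B≤bound : B ℤ.≤ bound
    B≤bound = ι-cancel-≤ (subst (λ v → NonNeg (v + - ι B)) (sym ι-bound)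
      (scale (NonNeg-+ (NonNeg-+ 1-z conj≥-β-1)
               (inj₁ (Pos-+ slack (Pos-+ Pos-2β-2 (Pos-+ Pos-γ (Pos-+ Pos-γ Pos-γ))))))
        (modulo (ι 1ℤ) L (modulo (- ι 1ℤ) L′ (solve 7 (λ β γ m z z′ A B →
          (m :* (((one :- z) :+ (z′ :+ (β :+ one)))
                 :+ ((β :+ γ) :* ((β :- one) :+ (one :- γ)) :+ (((β :- one) :+ (β :- one)) :+ (γ :+ (γ :+ γ)))))
            :+ (m :* z :- (A :+ B :* β)) :* one) :+ (m :* z′ :- (A :+ B :* (:- γ))) :* (:- one)
            := (m :* ((β :- γ) :+ con (ℤ.+ 3)) :- B) :* (β :+ γ)) refl β γ (ι m) z z′ (ι A) (ι B))))))

    -bound≤B : ℤ.- bound ℤ.≤ B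
    -bound≤B = ι-cancel-≤ (subst (λ v → NonNeg (ι B + - v)) (sym (trans (ι-neg bound) (cong -_ ι-bound)))
      (scale (NonNeg-+ (NonNeg-+ z+1 conj≤1)
               (inj₁ (Pos-+ slack (Pos-+ Pos-2β-2 (Pos-+ Pos-β (Pos-+ Pos-γ (Pos-+ Pos-γ Pos-γ)))))))
        (modulo (- ι 1ℤ) L (modulo (ι 1ℤ) L′ (solve 7 (λ β γ m z z′ A B →
          (m :* (((z :+ one) :+ (one :- z′))
                 :+ ((β :+ γ) :* ((β :- one) :+ (one :- γ)) :+ (((β :- one) :+ (β :- one)) :+ (β :+ (γ :+ (γ :+ γ))))))
            :+ (m :* z :- (A :+ B :* β)) :* (:- one)) :+ (m :* z′ :- (A :+ B :* (:- γ))) :* one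
            := (B :- (:- (m :* ((β :- γ) :+ con (ℤ.+ 3))))) :* (β :+ γ)) refl β γ (ι m) z z′ (ι A) (ι B))))))

    A≤bound : A ℤ.≤ bound
    A≤bound = ι-cancel-≤ (subst (λ v → NonNeg (v + - ι A)) (sym ι-bound)
      (scale (NonNeg-+ (NonNeg-+ (NonNeg-* (inj₁ Pos-γ) 1-z) (NonNeg-* (inj₁ Pos-β) conj≤1))
               (inj₁ (Pos-+ slack (Pos-+ Pos-β+γ Pos-β+γ))))
        (modulo γ L (modulo β L′ (solve 7 (λ β γ m z z′ A B →
          (m :* ((γ :* (one :- z) :+ β :* (one :- z′)) :+ ((β :+ γ) :* ((β :- one) :+ (one :- γ)) :+ ((β :+ γ) :+ (β :+ γ))))
            :+ (m :* z :- (A :+ B :* β)) :* γ) :+ (m :* z′ :- (A :+ B :* (:- γ))) :* β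
            := (m :* ((β :- γ) :+ con (ℤ.+ 3)) :- A) :* (β :+ γ)) refl β γ (ι m) z z′ (ι A) (ι B))))))

    -bound≤A : ℤ.- bound ℤ.≤ A
    -bound≤A = ι-cancel-≤ (subst (λ v → NonNeg (ι A + - v)) (sym (trans (ι-neg bound) (cong -_ ι-bound)))
      (scale (NonNeg-+ (NonNeg-+ (NonNeg-* (inj₁ Pos-γ) z+1) (NonNeg-* (inj₁ Pos-β) conj≥-β-1))
               (inj₁ (Pos-+ Pos-β+γ (Pos-+ Pos-β (Pos-* Pos-γ Pos-1-γ)))))
        (modulo (- γ) L (modulo (- β) L′ (solve 7 (λ β γ m z z′ A B →
          (m :* ((γ :* (z :+ one) :+ β :* (z′ :+ (β :+ one))) :+ ((β :+ γ) :+ (β :+ γ :* (one :- γ))))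
            :+ (m :* z :- (A :+ B :* β)) :* (:- γ)) :+ (m :* z′ :- (A :+ B :* (:- γ))) :* (:- β)
            := (A :- (:- (m :* ((β :- γ) :+ con (ℤ.+ 3))))) :* (β :+ γ)) refl β γ (ι m) z z′ (ι A) (ι B))))))

  module _ (bound : ℤ) where

    width : ℕ
    width = suc ℤ.∣ bound ℤ.+ bound ∣

    code : ∀ {a} → ℤ.- bound ℤ.≤ a → a ℤ.≤ bound → Fin width
    code {a} -b≤a a≤b = Fin.fromℕ< {ℤ.∣ a ℤ.+ bound ∣} (ℕ.s≤s (ℤ.drop‿+≤+
        (subst₂ ℤ._≤_ (sym (ℤ.0≤i⇒+∣i∣≡i 0≤a+b)) (sym (ℤ.0≤i⇒+∣i∣≡i (ℤ.≤-trans 0≤a+b a+b≤2b))) a+b≤2b)))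
      where
      0≤a+b : 0ℤ ℤ.≤ a ℤ.+ bound
      0≤a+b = subst (ℤ._≤ a ℤ.+ bound) (ℤ.+-inverseˡ bound) (ℤ.+-monoˡ-≤ bound -b≤a)
      a+b≤2b : a ℤ.+ bound ℤ.≤ bound ℤ.+ bound
      a+b≤2b = ℤ.+-monoˡ-≤ bound a≤b

    code-injective : ∀ {a c} (l : ℤ.- bound ℤ.≤ a) (h : a ℤ.≤ bound) (l′ : ℤ.- bound ℤ.≤ c) (h′ : c ℤ.≤ bound) →
                     code l h ≡ code l′ h′ → a ≡ c
    code-injective {a} {c} l h l′ h′ eq = ℤ-group.∙-cancelʳ bound a c (begin
      a ℤ.+ bound                  ≡⟨ ℤ.0≤i⇒+∣i∣≡i (nonNeg l) ⟨
      ℤ.+ ℤ.∣ a ℤ.+ bound ∣        ≡⟨ cong ℤ.+_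
                                        (trans (sym (Fin.toℕ-fromℕ< _)) (trans (cong Fin.toℕ eq) (Fin.toℕ-fromℕ< _))) ⟩
      ℤ.+ ℤ.∣ c ℤ.+ bound ∣        ≡⟨ ℤ.0≤i⇒+∣i∣≡i (nonNeg l′) ⟩
      c ℤ.+ bound                  ∎)
      where
      open ≡-Reasoning
      nonNeg : ∀ {a} → ℤ.- bound ℤ.≤ a → 0ℤ ℤ.≤ a ℤ.+ bound
      nonNeg {a} l = subst (ℤ._≤ a ℤ.+ bound) (ℤ.+-inverseˡ bound) (ℤ.+-monoˡ-≤ bound l)

  pair-repetition : ∀ {W} (f g : ℕ → Fin W) → ∃₂ λ i j → i ℕ.< j × f i ≡ f j × g i ≡ g j
  pair-repetition {W} f g with Fin.pigeonhole (ℕ.n<1+n (W ℕ.* W)) (λ i → Fin.combine (f (Fin.toℕ i)) (g (Fin.toℕ i)))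
  ... | i , j , i<j , eq = Fin.toℕ i , Fin.toℕ j , i<j , Fin.combine-injective _ _ _ _ eq

  Lattice-injective : ∀ {m y z} → Pos (ι m) → (l : Lattice m y) (l′ : Lattice m z) →
                      Lattice.A l ≡ Lattice.A l′ → Lattice.B l ≡ Lattice.B l′ → y ≡ z
  Lattice-injective {m} {y} {z} 0<m (lattice A B coords) (lattice A B coords′) refl refl = *-cancelʳ (ι m) 0<m (begin
    y * ι m          ≡⟨ *-comm _ _ ⟩
    ι m * y          ≡⟨ coords ⟩
    ι A + ι B * β    ≡⟨ coords′ ⟨
    ι m * z          ≡⟨ *-comm _ _ ⟩
    z * ι m          ∎)
    where open ≡-Reasoning

  repetition : ∀ {m} → Pos (ι m) → (z : ℕ → K) → (∀ k → Lattice m (z k)) → (∀ k → Bounded (z k)) →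
               ∃₂ λ i j → i ℕ.< j × z i ≡ z j
  repetition {m} 0<m z lat bdd = i , j , i<j , Lattice-injective 0<m (lat i) (lat j)
      (code-injective b (C.-bound≤A i) (C.A≤bound i) (C.-bound≤A j) (C.A≤bound j) codeA≡)
      (code-injective b (C.-bound≤B i) (C.B≤bound i) (C.-bound≤B j) (C.B≤bound j) codeB≡)
    where
    -- The bound depends only on m and p, so the codes of all the points lie in the same finite
    -- type.
    b : ℤ
    b = m ℤ.* (p ℤ.+ ℤ.+ 3)
    module C (k : ℕ) = Coordinates 0<m (lat k) (bdd k)
    collision : ∃₂ λ i j → i ℕ.< j × code b (C.-bound≤A i) (C.A≤bound i) ≡ code b (C.-bound≤A j) (C.A≤bound j)
                                   × code b (C.-bound≤B i) (C.B≤bound i) ≡ code b (C.-bound≤B j) (C.B≤bound j)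
    collision = pair-repetition (λ k → code b (C.-bound≤A k) (C.A≤bound k)) (λ k → code b (C.-bound≤B k) (C.B≤bound k))
    i j : ℕ
    i = proj₁ collision
    j = proj₁ (proj₂ collision)
    i<j : i ℕ.< j
    i<j = proj₁ (proj₂ (proj₂ collision))
    codeA≡ = proj₁ (proj₂ (proj₂ (proj₂ collision)))
    codeB≡ = proj₂ (proj₂ (proj₂ (proj₂ collision)))

  -- Existence of digits

  floorUpTo : ℕ → K → ℤ
  -- The axioms provide no floor, but digits lie between 0 and p, so a downward search suffices. For
  -- 0 ≤ y < n + 1 it gets down to this case only when y < 1, where 0 is the correct value.
  floorUpTo zero    y = 0ℤ
  floorUpTo (suc n) y with Pos-or-neg (ι (ℤ.+ suc n) + - y)
  ... | inj₁ _ = floorUpTo n y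
  ... | inj₂ _ = ℤ.+ suc n

  floorUpTo-spec : ∀ n y → NonNeg y → Pos ((ι (ℤ.+ n) + ι 1ℤ) + - y) →
                   NonNeg (y + - ι (floorUpTo n y)) × Pos ((ι (floorUpTo n y) + ι 1ℤ) + - y)
  floorUpTo-spec zero    y ny h = subst NonNeg (solve 1 (λ y → y := y :- con 0ℤ) refl y) ny , h
  floorUpTo-spec (suc n) y ny h with Pos-or-neg (ι (ℤ.+ suc n) + - y)
  ... | inj₁ y<sn = floorUpTo-spec n y ny (subst (λ v → Pos (v + - y)) (trans (ι-+ 1ℤ (ℤ.+ n)) (+-comm _ _)) y<sn)
  ... | inj₂ sn≤y = subst NonNeg (solve 2 (λ s y → :- (s :- y) := y :- s) refl (ι (ℤ.+ suc n)) y) sn≤y , h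

  digitOf : K → ℤ
  digitOf t = floorUpTo ℤ.∣ p ∣ (digitArgument t)

  0≤p : 0ℤ ℤ.≤ p
  0≤p = <⇒≤pred (subst (λ v → Pos ((v + ι 1ℤ) + - ι 0ℤ)) (sym ι-p)
    (subst Pos (solve 2 (λ β γ → β :+ (one :- γ) := ((β :- γ) :+ one) :- con 0ℤ) refl β γ) (Pos-+ Pos-β Pos-1-γ)))

  digitOf-spec : ∀ {t} → InInterval t → Digit t (digitOf t)
  digitOf-spec {t} (interval lower upper) with floorUpTo-spec ℤ.∣ p ∣ (digitArgument t)
      (inj₁ (subst Pos (solve 3 (λ β u t → β :* (u :- t) := :- (β :* t) :+ β :* u) refl β u t) (Pos-* Pos-β upper)))
      (subst (λ v → Pos ((v + ι 1ℤ) + - digitArgument t)) (sym (trans (cong ι (ℤ.0≤i⇒+∣i∣≡i 0≤p)) ι-p))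
        (subst Pos (modulo (- β) F (solve 4 (λ β γ u t →
            ((one :- γ) :+ β :* (t :+ β :* u)) :+ ((β :+ one) :* u :- one) :* (:- β)
              := ((β :- γ) :+ one) :- (:- (β :* t) :+ β :* u)) refl β γ u t))
          (Pos-NonNeg-+ Pos-1-γ (NonNeg-* (inj₁ Pos-β) lower))))
  ... | below , above = floor below above

  T : K → K
  T t = next t (digitOf t)

  T-domain : ∀ {t} → Domain t → Domain (T t)
  T-domain dom = next-domain dom (digitOf-spec (Domain.inInterval dom))

  T-injective : ∀ {s t} → Domain s → Domain t → T s ≡ T t → s ≡ t
  T-injective dom-s dom-t = next-injective dom-s dom-t (digitOf-spec (Domain.inInterval dom-s)) (digitOf-spec (Domain.inInterval dom-t))

  -- Orbits in the domain

  orbit : K → ℕ → K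
  orbit x zero    = x
  orbit x (suc k) = T (orbit x k)

  orbit-domain : ∀ {x} → Domain x → ∀ k → Domain (orbit x k)
  orbit-domain dom zero    = dom
  orbit-domain dom (suc k) = T-domain (orbit-domain dom k)

  orbit-lattice : ∀ {m x} → Lattice m x → ∀ k → Lattice m (orbit x k)
  orbit-lattice lat zero    = lat
  orbit-lattice lat (suc k) = next-lattice _ (orbit-lattice lat k)

  Domain⇒Bounded : ∀ {t} → Domain t → Bounded t
  Domain⇒Bounded (domain int conj≤0 conj≥-β-1 _) = bounded int (inj₁ (Pos-NonNeg-+ Pos-1 conj≤0)) conj≥-β-1

  orbit-rewind : ∀ {x} → Domain x → ∀ i n → orbit x i ≡ orbit x (i ℕ.+ n) → x ≡ orbit x n
  orbit-rewind dom zero    n eq = eq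
  orbit-rewind dom (suc i) n eq = orbit-rewind dom i n (T-injective (orbit-domain dom i) (orbit-domain dom (i ℕ.+ n)) eq)

  orbit-periodic : ∀ {x} n → x ≡ orbit x n → ∀ k → orbit x (k ℕ.+ n) ≡ orbit x k
  orbit-periodic n eq zero    = sym eq
  orbit-periodic n eq (suc k) = cong T (orbit-periodic n eq k)

  -- Arbitrary expansions

  module _ {t : ℕ → K} {d : ℕ → ℤ} (step : ∀ i → t (suc i) ≡ next (t i) (d i)) where

    -- For a fixed digit the step is an injective affine map. Periodic digits thus allow a
    -- coincidence to be pulled back without `Domain`, to which no positive rational belongs.
    rewind : ∀ n → (∀ i → d (i ℕ.+ n) ≡ d i) → ∀ i → t i ≡ t (i ℕ.+ n) → t 0 ≡ t n
    rewind n per zero    eq = eq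
    rewind n per (suc i) eq = rewind n per i (next-cancel (begin
      next (t i) (d i)                   ≡⟨ step i ⟨
      t (suc i)                          ≡⟨ eq ⟩
      t (suc i ℕ.+ n)                    ≡⟨ step (i ℕ.+ n) ⟩
      next (t (i ℕ.+ n)) (d (i ℕ.+ n))   ≡⟨ cong (next (t (i ℕ.+ n))) (per i) ⟩
      next (t (i ℕ.+ n)) (d i)           ∎))
      where open ≡-Reasoning

    module _ (int₀ : InInterval (t 0)) (dig : ∀ i → Digit (t i) (d i)) where

      intervals : ∀ k → InInterval (t k)
      intervals zero    = int₀
      intervals (suc k) = subst InInterval (sym (step k)) (next-interval (intervals k) (dig k))

      -- Since γ < 1 and d ≥ 0, c ≤ x implies γc - d ≤ γx < x. Taking x to be the starting point
      -- gives the final contradiction; taking x = 1 gives the upper bound in `bounds`.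
      conj-decreases : ∀ {x} → Pos x → NonNeg (x + - conj (t 0)) → ∀ k → Pos (x + - conj (t (suc k)))
      conj-decreases {x} 0<x h₀ k = subst (λ v → Pos (x + - v)) (sym (trans (cong conj (step k)) (conj-next (t k) (d k))))
        (subst Pos (solve 4 (λ γ x c d → (one :- γ) :* x :+ (γ :* (x :- c) :+ (d :- con 0ℤ)) := x :- (γ :* c :- d))
            refl γ x (conj (t k)) (ι (d k)))
          (Pos-NonNeg-+ (Pos-* Pos-1-γ 0<x) (NonNeg-+ (NonNeg-* (inj₁ Pos-γ) (weakly k)) (ι-mono-≤ (digit-nonNeg (intervals k) (dig k))))))
        where
        weakly : ∀ k → NonNeg (x + - conj (t k))
        weakly zero    = h₀
        weakly (suc k) = inj₁ (conj-decreases 0<x h₀ k)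

      bounds : NonNeg (ι 1ℤ + - conj (t 0)) → NonNeg (conj (t 0) + (β + ι 1ℤ)) → ∀ k → Bounded (t k)
      bounds h l k = bounded (intervals k) (upper k) (lower k)
        where
        upper : ∀ k → NonNeg (ι 1ℤ + - conj (t k))
        upper zero    = h
        upper (suc k) = inj₁ (conj-decreases Pos-1 h k)
        lower : ∀ k → NonNeg (conj (t k) + (β + ι 1ℤ))
        lower zero    = l
        lower (suc k) = subst (λ v → NonNeg (conj v + (β + ι 1ℤ))) (sym (step k))
          (conj-next-lower (t k) (d k) (digit≤p (intervals k) (dig k)) (lower k))

      lattices : ∀ {m} → Lattice m (t 0) → ∀ k → Lattice m (t k)
      lattices lat zero    = lat
      lattices lat (suc k) = subst (Lattice _) (sym (step k)) (next-lattice (d k) (lattices lat k))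

  -- Expansions of rational points over the abstract ring

  infix 4 _<_ _≤_

  _<_ _≤_ : K → K → Set
  x < y = Pos (y + - x)
  x ≤ y = x < y ⊎ x ≡ y

  -- The shapes here, including the factor `ι 1ℤ`, copy those in `Field`, so that over `QF` the two
  -- versions agree by computation.
  InI : K → Set
  InI x = (- (β * u)) ≤ x × x < (ι 1ℤ * u)

  IsFloor : K → ℤ → Set
  IsFloor y n = ι n ≤ y × y < ι (n ℤ.+ 1ℤ)

  IsExpansion : K → (ℕ → ℤ) → (ℕ → K) → Set
  IsExpansion x d t = t 0 ≡ x × (∀ i → IsFloor (digitArgument (t i)) (d i)) × (∀ i → t (suc i) ≡ next (t i) (d i))

  PurelyPeriodic : (ℕ → ℤ) → Set
  PurelyPeriodic d = Σ ℕ λ N → 1 ℕ.≤ N × (∀ i → d (i ℕ.+ N) ≡ d i)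

  HasPurelyPeriodicExpansion : K → Set
  HasPurelyPeriodicExpansion x = Σ (ℕ → ℤ) λ d → Σ (ℕ → K) λ t → IsExpansion x d t × PurelyPeriodic d

  ≤⇒NonNeg : ∀ {x y} → x ≤ y → NonNeg (y + - x)
  ≤⇒NonNeg (inj₁ h)    = inj₁ h
  ≤⇒NonNeg (inj₂ refl) = inj₂ (-‿inverseʳ _)

  NonNeg⇒≤ : ∀ {x y} → NonNeg (y + - x) → x ≤ y
  NonNeg⇒≤ (inj₁ h) = inj₁ h
  NonNeg⇒≤ {x} {y} (inj₂ eq) = inj₂ (sym (trans (solve 2 (λ x y → y := (y :- x) :+ x) refl x y) (trans (cong (_+ x) eq) (+-identityˡ x))))

  IsFloor⇒Digit : ∀ {t d} → IsFloor (digitArgument t) d → Digit t d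
  IsFloor⇒Digit {t} {d} (l , h) = floor (≤⇒NonNeg l) (subst (λ v → Pos (v + - digitArgument t)) (ι-suc d) h)

  Digit⇒IsFloor : ∀ {t d} → Digit t d → IsFloor (digitArgument t) d
  Digit⇒IsFloor {t} {d} (floor l h) = NonNeg⇒≤ l , subst (λ v → Pos (v + - digitArgument t)) (sym (ι-suc d)) h

  InI⇒InInterval : ∀ {x} → InI x → InInterval x
  InI⇒InInterval {x} (l , h) = interval
    (subst NonNeg (solve 3 (λ β u x → x :- (:- (β :* u)) := x :+ β :* u) refl β u x) (≤⇒NonNeg l))
    (subst (λ v → Pos (v + - x)) (*-identityˡ u) h)

  -- For a self-conjugate x, the interval already gives x′ = x ≥ -βu ≥ -β, so the stronger lower
  -- bound holds on both sides of the fixed point.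
  rational-domain : ∀ {x} → conj x ≡ x → InInterval x → NonNeg (- x) → Domain x
  rational-domain {x} rat int x≤0 = domain int
    (subst (λ v → NonNeg (- v)) (sym rat) x≤0)
    (subst (λ v → NonNeg (v + (β + ι 1ℤ))) (sym rat) (subst NonNeg (solve 2 (λ β x → (x :+ β) :+ one := x :+ (β :+ one)) refl β x)
      (NonNeg-+ x≥-β (inj₁ Pos-1))))
    (λ _ → subst (λ v → NonNeg (v + β)) (sym rat) x≥-β)
    where
    x≥-β : NonNeg (x + β)
    x≥-β = subst NonNeg (modulo (- β) F (solve 3 (λ β u x →
        ((x :+ β :* u) :+ β :* (β :* u)) :+ ((β :+ one) :* u :- one) :* (:- β) := x :+ β) refl β u x))
      (NonNeg-+ (InInterval.lower int) (NonNeg-* (inj₁ Pos-β) (inj₁ (Pos-* Pos-β Pos-u))))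

  module Rational {x : K} {m n : ℤ} (rat : conj x ≡ x) (0<m : Pos (ι m)) (fraction : ι m * x ≡ ι n) (x∈I : InI x) where

    private
      lat : Lattice m x
      lat = lattice n 0ℤ (trans fraction (solve 2 (λ n β → n := n :+ con 0ℤ :* β) refl (ι n) β))

      int : InInterval x
      int = InI⇒InInterval x∈I

    nonPositive⇒purelyPeriodic : NonNeg (- x) → HasPurelyPeriodicExpansion x
    nonPositive⇒purelyPeriodic x≤0 = conclude (repetition 0<m (orbit x) (orbit-lattice lat) (λ k → Domain⇒Bounded (orbit-domain dom k)))
      where
      dom : Domain x
      dom = rational-domain rat int x≤0

      conclude : (∃₂ λ i j → i ℕ.< j × orbit x i ≡ orbit x j) → HasPurelyPeriodicExpansion x
      conclude (i , j , i<j , eq) = (λ k → digitOf (orbit x k)) , orbit x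
        , (refl , (λ k → Digit⇒IsFloor (digitOf-spec (Domain.inInterval (orbit-domain dom k)))) , (λ _ → refl))
        , (j ℕ.∸ i , ℕ.m<n⇒0<n∸m i<j , λ k → cong digitOf (orbit-periodic (j ℕ.∸ i) returns k))
        where
        returns : x ≡ orbit x (j ℕ.∸ i)
        returns = orbit-rewind dom i (j ℕ.∸ i) (trans eq (cong (orbit x) (sym (ℕ.m+[n∸m]≡n (ℕ.<⇒≤ i<j)))))

    positive⇒¬purelyPeriodic : Pos x → ¬ HasPurelyPeriodicExpansion x
    positive⇒¬purelyPeriodic 0<x (d , t , (start , floors , step) , (suc N , _ , per)) =
      -- Only multiples of the period are sampled: two such indices differ by a period of d, as
      -- `rewind` requires.
      conclude (repetition 0<m (λ k → t (k ℕ.* suc N)) (λ k → lattices step int₀ dig lat₀ _)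
        (λ k → bounds step int₀ dig conj≤1 conj≥ _))
      where
      int₀ : InInterval (t 0)
      int₀ = subst InInterval (sym start) int

      dig : ∀ i → Digit (t i) (d i)
      dig i = IsFloor⇒Digit (floors i)

      lat₀ : Lattice m (t 0)
      lat₀ = subst (Lattice m) (sym start) lat

      conj₀ : conj (t 0) ≡ x
      conj₀ = trans (cong conj start) rat

      conj≤1 : NonNeg (ι 1ℤ + - conj (t 0))
      conj≤1 = subst (λ v → NonNeg (ι 1ℤ + - v)) (sym conj₀) (inj₁ (interval<1 int))

      conj≥ : NonNeg (conj (t 0) + (β + ι 1ℤ))
      conj≥ = subst (λ v → NonNeg (v + (β + ι 1ℤ))) (sym conj₀) (inj₁ (Pos-+ 0<x Pos-β+1))

      per-multiple : ∀ k i → d (i ℕ.+ k ℕ.* suc N) ≡ d i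
      per-multiple zero    i = cong d (ℕ.+-identityʳ i)
      per-multiple (suc k) i = trans (cong d (sym (ℕ.+-assoc i (suc N) (k ℕ.* suc N)))) (trans (per-multiple k (i ℕ.+ suc N)) (per i))

      conclude : ¬ (∃₂ λ i j → i ℕ.< j × t (i ℕ.* suc N) ≡ t (j ℕ.* suc N))
      conclude (i , j , i<j , eq) = ¬Pos-0 (subst Pos (trans (cong (λ v → x + - v) (trans (cong conj (sym returns)) conj₀)) (-‿inverseʳ x))
          (conj-decreases step int₀ dig 0<x (inj₂ (trans (cong (λ v → x + - v) conj₀) (-‿inverseʳ x))) _))
        where
        -- With j - i written as `suc c`, the index of return is visibly a successor, the form that
        -- `conj-decreases` needs for strictness.
        c : ℕ
        c = j ℕ.∸ suc i

        j≡i+1+c : j ≡ i ℕ.+ suc c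
        j≡i+1+c = trans (sym (ℕ.m+[n∸m]≡n i<j)) (sym (ℕ.+-suc i c))

        returns : t 0 ≡ t (suc c ℕ.* suc N)
        returns = rewind step _ (per-multiple (suc c)) (i ℕ.* suc N)
          (trans eq (cong t (trans (cong (ℕ._* suc N) j≡i+1+c) (ℕ.*-distribʳ-+ (suc N) i (suc c)))))

-- Arithmetic and order of the rationals

ℚ-ring : AlmostCommutativeRing 0ℓ 0ℓ
ℚ-ring = fromCommutativeRing ℚ.+-*-commutativeRing isZero
  where
  isZero : ∀ x → _
  isZero x with 0ℚ ℚ.≟ x
  ... | yes eq = just eq
  ... | no _   = nothing

module _ where
  open import Data.Rational using (_+_; _-_; _*_; -_; _<_; _≤_; positive; nonNegative)

  +-pos : ∀ {x y} → 0ℚ < x → 0ℚ < y → 0ℚ < x + y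
  +-pos = ℚ.+-mono-<

  +-pos-nonNeg : ∀ {x y} → 0ℚ < x → 0ℚ ≤ y → 0ℚ < x + y
  +-pos-nonNeg = ℚ.+-mono-<-≤

  *-pos : ∀ {x y} → 0ℚ < x → 0ℚ < y → 0ℚ < x * y
  *-pos {x} {y} 0<x 0<y = subst (_< x * y) (ℚ.*-zeroʳ x) (ℚ.*-monoʳ-<-pos x {{positive 0<x}} 0<y)

  *-nonNeg : ∀ {x y} → 0ℚ ≤ x → 0ℚ ≤ y → 0ℚ ≤ x * y
  *-nonNeg {x} {y} 0≤x 0≤y = subst (_≤ x * y) (ℚ.*-zeroʳ x) (ℚ.*-monoˡ-≤-nonNeg x {{nonNegative 0≤x}} 0≤y)

  neg-pos : ∀ {x} → x < 0ℚ → 0ℚ < - x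
  neg-pos = ℚ.neg-antimono-<

  neg-involutive : ∀ x → - - x ≡ x
  neg-involutive = solve-∀ ℚ-ring

  neg-neg : ∀ {x} → 0ℚ < - x → x < 0ℚ
  neg-neg {x} h = subst (_< 0ℚ) (neg-involutive x) (ℚ.neg-antimono-< h)

  <⇒0<- : ∀ {x y} → x < y → 0ℚ < y - x
  <⇒0<- {x} {y} h = subst (_< y - x) (ℚ.+-inverseʳ x) (ℚ.+-monoˡ-< (- x) h)

  sub-add : ∀ x y → (y - x) + x ≡ y
  sub-add = solve-∀ ℚ-ring

  0<-⇒< : ∀ {x y} → 0ℚ < y - x → x < y
  0<-⇒< {x} {y} h = subst₂ _<_ (ℚ.+-identityˡ x) (sub-add x y) (ℚ.+-monoˡ-< x h)

  neg-square : ∀ x → - x * - x ≡ x * x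
  neg-square = solve-∀ ℚ-ring

  square-nonNeg : ∀ x → 0ℚ ≤ x * x
  square-nonNeg x with ℚ.≤-total 0ℚ x
  ... | inj₁ 0≤x = *-nonNeg 0≤x 0≤x
  ... | inj₂ x≤0 = subst (0ℚ ≤_) (neg-square x) (*-nonNeg 0≤-x 0≤-x)
    where
    0≤-x : 0ℚ ≤ - x
    0≤-x = ℚ.neg-antimono-≤ x≤0

  square-difference : ∀ x y → (x - y) * (x + y) ≡ x * x - y * y
  square-difference = solve-∀ ℚ-ring

  twice-minus : ∀ x y → (x + x) + - (x + y) ≡ x - y
  twice-minus = solve-∀ ℚ-ring

  -- The hypotheses mean |y| < x. If x + y ≤ 0, then x - y = 2x - (x + y) > 0 and x² - y² = (x -
  -- y)(x + y) ≤ 0.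
  dominated-sum : ∀ x y → 0ℚ < x → 0ℚ < x * x - y * y → 0ℚ < x + y
  dominated-sum x y 0<x h with 0ℚ ℚ.<? x + y
  ... | yes 0<s = 0<s
  ... | no ¬0<s = ⊥-elim (ℚ.<-irrefl refl (ℚ.<-≤-trans h
      (subst (_≤ 0ℚ) (square-difference x y)
        (subst ((x - y) * (x + y) ≤_) (ℚ.*-zeroʳ (x - y))
          (ℚ.*-monoˡ-≤-nonNeg (x - y) {{nonNegative (ℚ.<⇒≤ 0<x-y)}} s≤0)))))
    where
    s≤0 : x + y ≤ 0ℚ
    s≤0 = ℚ.≮⇒≥ ¬0<s

    0<x-y : 0ℚ < x - y
    0<x-y = subst (0ℚ <_) (twice-minus x y) (+-pos-nonNeg (+-pos 0<x 0<x) (ℚ.neg-antimono-≤ s≤0))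

  square-zero : ∀ x → x * x ≡ 0ℚ → x ≡ 0ℚ
  square-zero x h with ℚ.<-cmp x 0ℚ
  ... | tri< x<0 _ _ = ⊥-elim (ℚ.<-irrefl (sym (trans (neg-square x) h)) (*-pos (neg-pos x<0) (neg-pos x<0)))
  ... | tri≈ _ eq _ = eq
  ... | tri> _ _ 0<x = ⊥-elim (ℚ.<-irrefl (sym h) (*-pos 0<x 0<x))

-- Fractions are normalised by a gcd and do not compute on variables, so this identity and the next
-- ones are checked on unnormalised fractions and pulled back by injectivity.
/1-+ : ∀ m n → (m ℤ.+ n) ℚ./ 1 ≡ (m ℚ./ 1) ℚ.+ (n ℚ./ 1)
/1-+ m n = ℚ.toℚᵘ-injective (begin
  ℚ.toℚᵘ ((m ℤ.+ n) ℚ./ 1)                    ≈⟨ ℚ.toℚᵘ-fromℚᵘ (ℚᵘ.mkℚᵘ (m ℤ.+ n) 0) ⟩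
  ℚᵘ.mkℚᵘ (m ℤ.+ n) 0                          ≈⟨ ℚᵘ.*≡* (cong (ℤ._* ℤ.+ 1)
                                                    (cong₂ ℤ._+_ (sym (ℤ.*-identityʳ m)) (sym (ℤ.*-identityʳ n)))) ⟩
  ℚᵘ.mkℚᵘ m 0 ℚᵘ.+ ℚᵘ.mkℚᵘ n 0                 ≈⟨ ℚᵘ.+-cong (ℚ.toℚᵘ-fromℚᵘ (ℚᵘ.mkℚᵘ m 0)) (ℚ.toℚᵘ-fromℚᵘ (ℚᵘ.mkℚᵘ n 0)) ⟨
  ℚ.toℚᵘ (m ℚ./ 1) ℚᵘ.+ ℚ.toℚᵘ (n ℚ./ 1)       ≈⟨ ℚ.toℚᵘ-homo-+ (m ℚ./ 1) (n ℚ./ 1) ⟨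
  ℚ.toℚᵘ ((m ℚ./ 1) ℚ.+ (n ℚ./ 1))                 ∎)
  where open ℚᵘ.≃-Reasoning

/1-* : ∀ m n → (m ℤ.* n) ℚ./ 1 ≡ (m ℚ./ 1) ℚ.* (n ℚ./ 1)
/1-* m n = ℚ.toℚᵘ-injective (begin
  ℚ.toℚᵘ ((m ℤ.* n) ℚ./ 1)                    ≈⟨ ℚ.toℚᵘ-fromℚᵘ (ℚᵘ.mkℚᵘ (m ℤ.* n) 0) ⟩
  ℚᵘ.mkℚᵘ m 0 ℚᵘ.* ℚᵘ.mkℚᵘ n 0                 ≈⟨ ℚᵘ.*-cong (ℚ.toℚᵘ-fromℚᵘ (ℚᵘ.mkℚᵘ m 0)) (ℚ.toℚᵘ-fromℚᵘ (ℚᵘ.mkℚᵘ n 0)) ⟨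
  ℚ.toℚᵘ (m ℚ./ 1) ℚᵘ.* ℚ.toℚᵘ (n ℚ./ 1)       ≈⟨ ℚ.toℚᵘ-homo-* (m ℚ./ 1) (n ℚ./ 1) ⟨
  ℚ.toℚᵘ ((m ℚ./ 1) ℚ.* (n ℚ./ 1))                 ∎)
  where open ℚᵘ.≃-Reasoning

/1-neg : ∀ n → (ℤ.- n) ℚ./ 1 ≡ ℚ.- (n ℚ./ 1)
/1-neg n = ℚ.toℚᵘ-injective (begin
  ℚ.toℚᵘ ((ℤ.- n) ℚ./ 1)     ≈⟨ ℚ.toℚᵘ-fromℚᵘ (ℚᵘ.mkℚᵘ (ℤ.- n) 0) ⟩
  ℚᵘ.- ℚᵘ.mkℚᵘ n 0           ≈⟨ ℚᵘ.-‿cong (ℚ.toℚᵘ-fromℚᵘ (ℚᵘ.mkℚᵘ n 0)) ⟨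
  ℚᵘ.- ℚ.toℚᵘ (n ℚ./ 1)      ≈⟨ ℚ.toℚᵘ-homo‿- (n ℚ./ 1) ⟨
  ℚ.toℚᵘ (ℚ.- (n ℚ./ 1))     ∎)
  where open ℚᵘ.≃-Reasoning

/2 : ∀ n → n ℚ./ 2 ≡ n ℚ./ 1 ℚ.* ℚ.½
/2 n = ℚ.toℚᵘ-injective (begin
  ℚ.toℚᵘ (n ℚ./ 2)                   ≈⟨ ℚ.toℚᵘ-fromℚᵘ (ℚᵘ.mkℚᵘ n 1) ⟩
  ℚᵘ.mkℚᵘ n 1                         ≈⟨ ℚᵘ.*≡* (cong (ℤ._* ℤ.+ 2) (sym (ℤ.*-identityʳ n))) ⟩
  ℚᵘ.mkℚᵘ n 0 ℚᵘ.* ℚᵘ.½               ≈⟨ ℚᵘ.*-cong (ℚ.toℚᵘ-fromℚᵘ (ℚᵘ.mkℚᵘ n 0)) (ℚᵘ.≃-refl {ℚᵘ.½}) ⟨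
  ℚ.toℚᵘ (n ℚ./ 1) ℚᵘ.* ℚᵘ.½         ≈⟨ ℚ.toℚᵘ-homo-* (n ℚ./ 1) ℚ.½ ⟨
  ℚ.toℚᵘ (n ℚ./ 1 ℚ.* ℚ.½)           ∎)
  where open ℚᵘ.≃-Reasoning

denominator-clears : ∀ x → (ℚ.↧ x) ℚ./ 1 ℚ.* x ≡ (ℚ.↥ x) ℚ./ 1
denominator-clears x@record{} = ℚ.toℚᵘ-injective (begin
  ℚ.toℚᵘ ((ℚ.↧ x) ℚ./ 1 ℚ.* x)              ≈⟨ ℚ.toℚᵘ-homo-* ((ℚ.↧ x) ℚ./ 1) x ⟩
  ℚ.toℚᵘ ((ℚ.↧ x) ℚ./ 1) ℚᵘ.* ℚ.toℚᵘ x      ≈⟨ ℚᵘ.*-cong (ℚ.toℚᵘ-fromℚᵘ (ℚᵘ.mkℚᵘ (ℚ.↧ x) 0)) (ℚᵘ.≃-refl {ℚ.toℚᵘ x}) ⟩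
  ℚᵘ.mkℚᵘ (ℚ.↧ x) 0 ℚᵘ.* ℚ.toℚᵘ x           ≈⟨ ℚᵘ.*≡* (trans (ℤ.*-identityʳ _)
                                                 (trans (ℤ.*-comm (ℚ.↧ x) (ℚ.↥ x)) (cong (ℚ.↥ x ℤ.*_) (sym (ℤ.*-identityˡ (ℚ.↧ x)))))) ⟩
  ℚᵘ.mkℚᵘ (ℚ.↥ x) 0                          ≈⟨ ℚ.toℚᵘ-fromℚᵘ (ℚᵘ.mkℚᵘ (ℚ.↥ x) 0) ⟨
  ℚ.toℚᵘ ((ℚ.↥ x) ℚ./ 1)                     ∎)
  where open ℚᵘ.≃-Reasoning

/1-injective : ∀ m n → m ℚ./ 1 ≡ n ℚ./ 1 → m ≡ n
/1-injective m n eq with ℚᵘ.≃-trans (ℚᵘ.≃-sym (ℚ.toℚᵘ-fromℚᵘ (ℚᵘ.mkℚᵘ m 0)))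
                         (ℚᵘ.≃-trans (ℚᵘ.≃-reflexive (cong ℚ.toℚᵘ eq)) (ℚ.toℚᵘ-fromℚᵘ (ℚᵘ.mkℚᵘ n 0)))
... | ℚᵘ.*≡* h = trans (sym (ℤ.*-identityʳ m)) (trans h (ℤ.*-identityʳ n))

-- The denominator d divides n·n and is coprime to n, so it divides n and must be 1.
square-factor : ∀ m n d → Coprime n d → n ℕ.* n ≡ m ℕ.* (d ℕ.* d) → n ℕ.* n ≡ m
square-factor m n d coprime eq = trans eq (trans (cong (λ k → m ℕ.* (k ℕ.* k)) d≡1) (ℕ.*-identityʳ m))
  where
  d∣n : d ∣ n
  d∣n = coprime-divisor (Coprimality.sym coprime) (divides (m ℕ.* d) (trans eq (sym (ℕ.*-assoc m d d))))

  d≡1 : d ≡ 1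
  d≡1 = coprime (d∣n , ∣-refl)

-- The field Q(√D) and the sign of its elements

module QuadraticField (D : ℕ) (nonsquare : ∀ m → m ℕ.* m ≢ D) where

  open Field D
  open import Data.Rational using (_+_; _-_; _*_; -_; _<_; _≤_)

  rational-square : ∀ x → x * x ≢ Dq
  rational-square x@(mkℚ n d-1 coprime) h = nonsquare ℤ.∣ n ∣ (square-factor D ℤ.∣ n ∣ d (Coprimality.recompute coprime) eqℕ)
    where
    open ≡-Reasoning
    d = ℕ.suc d-1

    regroup : ∀ b y → (b * y) * (b * y) ≡ (y * y) * (b * b)
    regroup = solve-∀ ℚ-ring

    eqℤ : n ℤ.* n ≡ ℤ.+ D ℤ.* (ℤ.+ d ℤ.* ℤ.+ d)
    eqℤ = /1-injective _ _ (begin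
      (n ℤ.* n) ℚ./ 1                                 ≡⟨ /1-* n n ⟩
      (n ℚ./ 1) * (n ℚ./ 1)                           ≡⟨ cong₂ _*_ (denominator-clears x) (denominator-clears x) ⟨
      ((ℤ.+ d) ℚ./ 1 * x) * ((ℤ.+ d) ℚ./ 1 * x)           ≡⟨ regroup ((ℤ.+ d) ℚ./ 1) x ⟩
      (x * x) * ((ℤ.+ d) ℚ./ 1 * ((ℤ.+ d) ℚ./ 1))         ≡⟨ cong₂ _*_ h (sym (/1-* (ℤ.+ d) (ℤ.+ d))) ⟩
      Dq * ((ℤ.+ d ℤ.* ℤ.+ d) ℚ./ 1)                      ≡⟨ /1-* (ℤ.+ D) (ℤ.+ d ℤ.* ℤ.+ d) ⟨
      (ℤ.+ D ℤ.* (ℤ.+ d ℤ.* ℤ.+ d)) ℚ./ 1                   ∎)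

    eqℕ : ℤ.∣ n ∣ ℕ.* ℤ.∣ n ∣ ≡ D ℕ.* (d ℕ.* d)
    eqℕ = trans (sym (ℤ.abs-* n n)) (trans (cong ℤ.∣_∣ eqℤ)
            (trans (ℤ.abs-* (ℤ.+ D) (ℤ.+ d ℤ.* ℤ.+ d)) (cong (D ℕ.*_) (ℤ.abs-* (ℤ.+ d) (ℤ.+ d)))))

  norm : QF → ℚ
  norm (a ⊕ b √) = a * a - b * b * Dq

  conj : QF → QF
  conj (a ⊕ b √) = a ⊕ (- b) √

  0F : QF
  0F = 0ℚ ⊕ 0ℚ √

  0≤Dq : 0ℚ ≤ Dq
  0≤Dq = ℚ.nonNegative⁻¹ Dq {{ℚ.normalize-nonNeg D 1}}

  private
    add-sub : ∀ x y → x ≡ (x - y) + y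
    add-sub = solve-∀ ℚ-ring

    quotient-square : ∀ a c → (a * c) * (a * c) ≡ a * a * (c * c)
    quotient-square = solve-∀ ℚ-ring

    cancel-square : ∀ b c D → (b * b * D) * (c * c) ≡ (b * c) * (b * c) * D
    cancel-square = solve-∀ ℚ-ring

  norm≡0⇒≡0 : ∀ z → norm z ≡ 0ℚ → z ≡ 0F
  norm≡0⇒≡0 (a ⊕ b √) h with b ℚ.≟ 0ℚ
  ... | yes refl = cong (_⊕ 0ℚ √) (square-zero a (trans (add-sub (a * a) (0ℚ * 0ℚ * Dq))
          (trans (cong (_+ 0ℚ * 0ℚ * Dq) h) (trans (ℚ.+-identityˡ _) (ℚ.*-zeroˡ Dq)))))
  ... | no b≢0 = ⊥-elim (rational-square (a * c) (begin
      (a * c) * (a * c)         ≡⟨ quotient-square a c ⟩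
      a * a * (c * c)           ≡⟨ cong (_* (c * c)) a²≡b²D ⟩
      b * b * Dq * (c * c)      ≡⟨ cancel-square b c Dq ⟩
      (b * c) * (b * c) * Dq    ≡⟨ cong (λ e → e * e * Dq) (ℚ.*-inverseʳ b {{ℚ.≢-nonZero b≢0}}) ⟩
      1ℚ * 1ℚ * Dq              ≡⟨ ℚ.*-identityˡ Dq ⟩
      Dq                        ∎))
    where
    open ≡-Reasoning
    c : ℚ
    c = (ℚ.1/ b) {{ℚ.≢-nonZero b≢0}}

    a²≡b²D : a * a ≡ b * b * Dq
    a²≡b²D = trans (add-sub (a * a) (b * b * Dq)) (trans (cong (_+ b * b * Dq) h) (ℚ.+-identityˡ _))

  -- The sign of a + b√D is that of the dominating one of the two terms.
  Positive : QF → Set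
  Positive z = (0ℚ < re z × 0ℚ < norm z) ⊎ (0ℚ < im z × norm z < 0ℚ)

  private
    norm-mul : ∀ a b c d D → (a * c + b * d * D) * (a * c + b * d * D) - (a * d + b * c) * (a * d + b * c) * D
               ≡ (a * a - b * b * D) * (c * c - d * d * D)
    norm-mul = solve-∀ ℚ-ring

    sq-LL : ∀ a b c d D → (a * a - b * b * D) * (c * c - d * d * D) + ((a * a - b * b * D) * (d * d * D) + (c * c - d * d * D) * (b * b * D))
            ≡ (a * c) * (a * c) - (b * d * D) * (b * d * D)
    sq-LL = solve-∀ ℚ-ring

    sq-LR : ∀ a b c d D → (a * a - b * b * D) * (d * d) + - (c * c - d * d * D) * (b * b)
            ≡ (a * d) * (a * d) - (b * c) * (b * c)
    sq-LR = solve-∀ ℚ-ring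

    sq-RR : ∀ a b c d D → - (a * a - b * b * D) * - (c * c - d * d * D) + (a * a * - (c * c - d * d * D) + c * c * - (a * a - b * b * D))
            ≡ (b * d * D) * (b * d * D) - (a * c) * (a * c)
    sq-RR = solve-∀ ℚ-ring

    neg-mul-neg : ∀ x y → - x * - y ≡ x * y
    neg-mul-neg = solve-∀ ℚ-ring

    mul-neg : ∀ x y → x * - y ≡ - (x * y)
    mul-neg = solve-∀ ℚ-ring

    norm-neg : ∀ a b D → (- a) * (- a) - (- b) * (- b) * D ≡ a * a - b * b * D
    norm-neg = solve-∀ ℚ-ring

    norm-shift : ∀ r a b D → (r * r + (r * a + r * a)) + (a * a - b * b * D) ≡ (r + a) * (r + a) - (0ℚ + b) * (0ℚ + b) * D
    norm-shift = solve-∀ ℚ-ring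

    square-shift : ∀ r a b D → b * b * D - a * a + ((r + a) * (r + a) - (0ℚ + b) * (0ℚ + b) * D) ≡ r * (r + (a + a))
    square-shift = solve-∀ ℚ-ring

  norm-* : ∀ z w → norm (z *F w) ≡ norm z * norm w
  norm-* (a ⊕ b √) (c ⊕ d √) = norm-mul a b c d Dq

  *F-comm : ∀ z w → z *F w ≡ w *F z
  *F-comm (a ⊕ b √) (c ⊕ d √) = cong₂ _⊕_√ (comm₁ a b c d Dq) (comm₂ a b c d)
    where
    comm₁ : ∀ a b c d D → a * c + b * d * D ≡ c * a + d * b * D
    comm₁ = solve-∀ ℚ-ring
    comm₂ : ∀ a b c d → a * d + b * c ≡ c * b + d * a
    comm₂ = solve-∀ ℚ-ring

  0<Dq : 0ℚ < Dq
  0<Dq with ℚ.<-cmp 0ℚ Dq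
  ... | tri< h _ _ = h
  ... | tri≈ _ h _ = ⊥-elim (rational-square 0ℚ h)
  ... | tri> _ _ h = ⊥-elim (ℚ.<-irrefl refl (ℚ.<-≤-trans h 0≤Dq))

  square*Dq-nonNeg : ∀ b → 0ℚ ≤ b * b * Dq
  square*Dq-nonNeg b = *-nonNeg (square-nonNeg b) 0≤Dq

  -- The norm is multiplicative, so its sign tells which coefficient of the product decides. That
  -- coefficient is a sum of two terms, the first or second of which dominates by comparison of
  -- squares.
  Positive-* : ∀ z w → Positive z → Positive w → Positive (z *F w)
  Positive-* z@(a ⊕ b √) w@(c ⊕ d √) (inj₁ (0<a , 0<N)) (inj₁ (0<c , 0<M)) = inj₁
    ( dominated-sum (a * c) (b * d * Dq) (*-pos 0<a 0<c) (subst (0ℚ <_) (sq-LL a b c d Dq)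
        (+-pos-nonNeg (*-pos 0<N 0<M) (ℚ.+-mono-≤
          (*-nonNeg (ℚ.<⇒≤ 0<N) (square*Dq-nonNeg d)) (*-nonNeg (ℚ.<⇒≤ 0<M) (square*Dq-nonNeg b)))))
    , subst (0ℚ <_) (sym (norm-* z w)) (*-pos 0<N 0<M))
  Positive-* z@(a ⊕ b √) w@(c ⊕ d √) (inj₁ (0<a , 0<N)) (inj₂ (0<d , M<0)) = inj₂
    ( dominated-sum (a * d) (b * c) (*-pos 0<a 0<d) (subst (0ℚ <_) (sq-LR a b c d Dq)
        (+-pos-nonNeg (*-pos 0<N (*-pos 0<d 0<d)) (*-nonNeg (ℚ.<⇒≤ (neg-pos M<0)) (square-nonNeg b))))
    , subst (_< 0ℚ) (sym (norm-* z w)) (neg-neg (subst (0ℚ <_) (mul-neg (norm z) (norm w)) (*-pos 0<N (neg-pos M<0)))))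
  Positive-* z w (inj₂ pz) (inj₁ pw) = subst Positive (*F-comm w z) (Positive-* w z (inj₁ pw) (inj₂ pz))
  Positive-* z@(a ⊕ b √) w@(c ⊕ d √) (inj₂ (0<b , N<0)) (inj₂ (0<d , M<0)) = inj₁
    ( subst (0ℚ <_) (ℚ.+-comm (b * d * Dq) (a * c))
        (dominated-sum (b * d * Dq) (a * c) (*-pos (*-pos 0<b 0<d) 0<Dq) (subst (0ℚ <_) (sq-RR a b c d Dq)
          (+-pos-nonNeg (*-pos 0<-N 0<-M) (ℚ.+-mono-≤
            (*-nonNeg (square-nonNeg a) (ℚ.<⇒≤ 0<-M)) (*-nonNeg (square-nonNeg c) (ℚ.<⇒≤ 0<-N))))))
    , subst (0ℚ <_) (sym (norm-* z w)) (subst (0ℚ <_) (neg-mul-neg (norm z) (norm w)) (*-pos 0<-N 0<-M)))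
    where
    0<-N : 0ℚ < - norm z
    0<-N = neg-pos N<0
    0<-M : 0ℚ < - norm w
    0<-M = neg-pos M<0

  ¬Positive-0 : ¬ Positive 0F
  ¬Positive-0 (inj₁ (h , _)) = ℚ.<-irrefl refl h
  ¬Positive-0 (inj₂ (h , _)) = ℚ.<-irrefl refl h

  norm-negF : ∀ z → norm (-F z) ≡ norm z
  norm-negF (a ⊕ b √) = norm-neg a b Dq

  Positive-asym : ∀ z → Positive z → ¬ Positive (-F z)
  Positive-asym z (inj₁ (h , _)) (inj₁ (k , _)) = ℚ.<-asym h (neg-neg k)
  Positive-asym z (inj₂ (h , _)) (inj₂ (k , _)) = ℚ.<-asym h (neg-neg k)
  Positive-asym z (inj₁ (_ , h)) (inj₂ (_ , k)) = ℚ.<-asym h (subst (_< 0ℚ) (norm-negF z) k)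
  Positive-asym z (inj₂ (_ , h)) (inj₁ (_ , k)) = ℚ.<-asym h (subst (0ℚ <_) (norm-negF z) k)

  Positive-cmp : ∀ z → Positive z ⊎ z ≡ 0F ⊎ Positive (-F z)
  Positive-cmp z@(a ⊕ b √) with ℚ.<-cmp (norm z) 0ℚ
  ... | tri≈ _ h _ = inj₂ (inj₁ (norm≡0⇒≡0 z h))
  ... | tri> _ _ 0<N with ℚ.<-cmp a 0ℚ
  ...   | tri> _ _ 0<a  = inj₁ (inj₁ (0<a , 0<N))
  ...   | tri< a<0 _ _  = inj₂ (inj₂ (inj₁ (neg-pos a<0 , subst (0ℚ <_) (sym (norm-negF z)) 0<N)))
  ...   | tri≈ _ refl _ = ⊥-elim (ℚ.<-irrefl refl (ℚ.<-≤-trans 0<N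
            (subst (_≤ 0ℚ) (sym (ℚ.+-identityˡ _)) (ℚ.neg-antimono-≤ (square*Dq-nonNeg b)))))
  Positive-cmp z@(a ⊕ b √) | tri< N<0 _ _ with ℚ.<-cmp b 0ℚ
  ...   | tri> _ _ 0<b  = inj₁ (inj₂ (0<b , N<0))
  ...   | tri< b<0 _ _  = inj₂ (inj₂ (inj₂ (neg-pos b<0 , subst (_< 0ℚ) (sym (norm-negF z)) N<0)))
  ...   | tri≈ _ refl _ = ⊥-elim (ℚ.<-irrefl refl (ℚ.<-≤-trans N<0
            (subst (0ℚ ≤_) (sym (trans (cong (λ e → a * a - e) (ℚ.*-zeroˡ Dq)) (ℚ.+-identityʳ _))) (square-nonNeg a))))

  Positive-ι+ : ∀ r z → 0ℚ < r → Positive z → Positive (ι r +F z)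
  Positive-ι+ r z@(a ⊕ b √) 0<r (inj₁ (0<a , 0<N)) = inj₁
    ( +-pos 0<r 0<a
    , subst (0ℚ <_) (norm-shift r a b Dq) (+-pos (+-pos (*-pos 0<r 0<r) (+-pos (*-pos 0<r 0<a) (*-pos 0<r 0<a))) 0<N))
  Positive-ι+ r z@(a ⊕ b √) 0<r (inj₂ (0<b , N<0)) with ℚ.<-cmp (norm (ι r +F z)) 0ℚ
  ... | tri< h _ _ = inj₂ (subst (0ℚ <_) (sym (ℚ.+-identityˡ b)) 0<b , h)
  ... | tri≈ _ h _ = ⊥-elim (ℚ.<-irrefl (sym (trans (sym (ℚ.+-identityˡ b)) (cong im (norm≡0⇒≡0 (ι r +F z) h)))) 0<b)
  ... | tri> _ _ h with 0ℚ ℚ.<? r + a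
  ...   | yes k = inj₁ (k , h)
  -- Adding -norm z > 0 to the norm of r + z gives r(r + 2a) > 0, whereas r + a ≤ 0 would give r +
  -- 2a ≤ -r < 0.
  ...   | no ¬k = ⊥-elim (ℚ.<-asym 0<r (neg-neg (subst (0ℚ <_) (neg-gap r a)
            (+-pos-nonNeg 0<q (ℚ.neg-antimono-≤ (ℚ.+-mono-≤ s≤0 s≤0))))))
    where
    s≤0 : r + a ≤ 0ℚ
    s≤0 = ℚ.≮⇒≥ ¬k
    neg-gap : ∀ r a → (r + (a + a)) + - ((r + a) + (r + a)) ≡ - r
    neg-gap = solve-∀ ℚ-ring
    neg-sub : ∀ x y → - (x - y) ≡ y - x
    neg-sub = solve-∀ ℚ-ring
    0<rq : 0ℚ < r * (r + (a + a))
    0<rq = subst (0ℚ <_) (square-shift r a b Dq) (+-pos (subst (0ℚ <_) (neg-sub (a * a) (b * b * Dq)) (neg-pos N<0)) h)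
    0<q : 0ℚ < r + (a + a)
    0<q = ℚ.*-cancelˡ-<-nonNeg r {{ℚ.nonNegative (ℚ.<⇒≤ 0<r)}} (subst (_< r * (r + (a + a))) (sym (ℚ.*-zeroʳ r)) 0<rq)

-- Q(√D) as an ordered ring

module QuadraticOrder (D : ℕ) (nonsquare : ∀ m → m ℕ.* m ≢ D) where

  open Field D
  open QuadraticField D nonsquare
  open import Data.Rational using (_+_; _-_; _*_; -_; _<_; _≤_)

  QF-isCommutativeRing : IsCommutativeRing _≡_ _+F_ _*F_ -F_ 0F 1F
  QF-isCommutativeRing = record
    { isRing = record
      { +-isAbelianGroup = record
        { isGroup = record
          { isMonoid = record
            { isSemigroup = record
              { isMagma = record { isEquivalence = isEquivalence ; ∙-cong = cong₂ _+F_ }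
              ; assoc = λ x y z → cong₂ _⊕_√ (ℚ.+-assoc (re x) (re y) (re z)) (ℚ.+-assoc (im x) (im y) (im z))
              }
            ; identity = (λ x → cong₂ _⊕_√ (ℚ.+-identityˡ (re x)) (ℚ.+-identityˡ (im x)))
                       , (λ x → cong₂ _⊕_√ (ℚ.+-identityʳ (re x)) (ℚ.+-identityʳ (im x)))
            }
          ; inverse = (λ x → cong₂ _⊕_√ (ℚ.+-inverseˡ (re x)) (ℚ.+-inverseˡ (im x)))
                    , (λ x → cong₂ _⊕_√ (ℚ.+-inverseʳ (re x)) (ℚ.+-inverseʳ (im x)))
          ; ⁻¹-cong = cong (λ x → -F x)
          }
        ; comm = λ x y → cong₂ _⊕_√ (ℚ.+-comm (re x) (re y)) (ℚ.+-comm (im x) (im y))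
        }
      ; *-cong = cong₂ _*F_
      ; *-assoc = λ x y z → cong₂ _⊕_√ (assoc₁ (re x) (im x) (re y) (im y) (re z) (im z) Dq)
                                          (assoc₂ (re x) (im x) (re y) (im y) (re z) (im z) Dq)
      ; *-identity = (λ x → cong₂ _⊕_√ (identity₁ (re x) (im x) Dq) (identity₂ (re x) (im x)))
                   , (λ x → trans (*F-comm x 1F) (cong₂ _⊕_√ (identity₁ (re x) (im x) Dq) (identity₂ (re x) (im x))))
      ; distrib = distribˡ
                , (λ x y z → trans (*F-comm (y +F z) x) (trans (distribˡ x y z) (cong₂ _+F_ (*F-comm x y) (*F-comm x z))))
      }
    ; *-comm = *F-comm
    }
    where
    assoc₁ : ∀ a b c d e f D → (a * c + b * d * D) * e + (a * d + b * c) * f * D ≡ a * (c * e + d * f * D) + b * (c * f + d * e) * D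
    assoc₁ = solve-∀ ℚ-ring
    assoc₂ : ∀ a b c d e f D → (a * c + b * d * D) * f + (a * d + b * c) * e ≡ a * (c * f + d * e) + b * (c * e + d * f * D)
    assoc₂ = solve-∀ ℚ-ring
    identity₁ : ∀ a b D → 1ℚ * a + 0ℚ * b * D ≡ a
    identity₁ = solve-∀ ℚ-ring
    identity₂ : ∀ a b → 1ℚ * b + 0ℚ * a ≡ b
    identity₂ = solve-∀ ℚ-ring
    distrib₁ : ∀ a b c d e f D → a * (c + e) + b * (d + f) * D ≡ (a * c + b * d * D) + (a * e + b * f * D)
    distrib₁ = solve-∀ ℚ-ring
    distrib₂ : ∀ a b c d e f → a * (d + f) + b * (c + e) ≡ (a * d + b * c) + (a * f + b * e)
    distrib₂ = solve-∀ ℚ-ring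
    distribˡ : ∀ x y z → x *F (y +F z) ≡ x *F y +F x *F z
    distribˡ x y z = cong₂ _⊕_√ (distrib₁ (re x) (im x) (re y) (im y) (re z) (im z) Dq)
                                 (distrib₂ (re x) (im x) (re y) (im y) (re z) (im z))

  open IsCommutativeRing QF-isCommutativeRing using () renaming (distribˡ to *F-distribˡ; zeroʳ to *F-zeroʳ)

  private
    QF-ring : CommutativeRing _ _
    QF-ring = record { isCommutativeRing = QF-isCommutativeRing }

  open Algebra.Properties.Ring (CommutativeRing.ring QF-ring) using (-‿distribʳ-*)

  -- Multiplying by a positive zˢ with zˢz rational reduces sums to the case where one summand is rational.
  Positive-+-via : ∀ zˢ r z w → Positive zˢ → 0ℚ < r → zˢ *F z ≡ ι r → Positive (zˢ *F w) → Positive (z +F w)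
  Positive-+-via zˢ r z w pzˢ 0<r eq pzˢw with Positive-cmp (z +F w)
  ... | inj₁ h  = h
  ... | inj₂ ¬h = ⊥-elim (absurd ¬h)
    where
    multiple : Positive (zˢ *F (z +F w))
    multiple = subst Positive (sym (trans (*F-distribˡ zˢ z w) (cong (_+F zˢ *F w) eq))) (Positive-ι+ r (zˢ *F w) 0<r pzˢw)

    absurd : ¬ (z +F w ≡ 0F ⊎ Positive (-F (z +F w)))
    absurd (inj₁ h) = ¬Positive-0 (subst Positive (trans (cong (zˢ *F_) h) (*F-zeroʳ zˢ)) multiple)
    absurd (inj₂ h) = Positive-asym _ multiple
      (subst Positive (sym (-‿distribʳ-* zˢ (z +F w))) (Positive-* zˢ (-F (z +F w)) pzˢ h))

  Positive-+ : ∀ z w → Positive z → Positive w → Positive (z +F w)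
  Positive-+ z@(a ⊕ b √) w (inj₁ (0<a , 0<N)) pw = Positive-+-via (conj z) (norm z) z w pz̄ 0<N
      (cong₂ _⊕_√ (conj-norm a b Dq) (conj-cross a b)) (Positive-* (conj z) w pz̄ pw)
    where
    conj-norm : ∀ a b D → a * a + (- b) * b * D ≡ a * a - b * b * D
    conj-norm = solve-∀ ℚ-ring
    conj-cross : ∀ a b → a * b + (- b) * a ≡ 0ℚ
    conj-cross = solve-∀ ℚ-ring
    norm-conj : ∀ a b D → a * a - b * b * D ≡ a * a - (- b) * (- b) * D
    norm-conj = solve-∀ ℚ-ring
    pz̄ : Positive (conj z)
    pz̄ = inj₁ (0<a , subst (0ℚ <_) (norm-conj a b Dq) 0<N)
  Positive-+ z@(a ⊕ b √) w (inj₂ (0<b , N<0)) pw = Positive-+-via zˢ (- norm z) z w pzˢ (neg-pos N<0)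
      (cong₂ _⊕_√ (conj-norm a b Dq) (conj-cross a b)) (Positive-* zˢ w pzˢ pw)
    where
    -- The negated conjugate: its product with z is -norm z, which is positive in this case.
    zˢ : QF
    zˢ = (- a) ⊕ b √
    conj-norm : ∀ a b D → (- a) * a + b * b * D ≡ - (a * a - b * b * D)
    conj-norm = solve-∀ ℚ-ring
    conj-cross : ∀ a b → (- a) * b + b * a ≡ 0ℚ
    conj-cross = solve-∀ ℚ-ring
    norm-conj : ∀ a b D → a * a - b * b * D ≡ (- a) * (- a) - b * b * D
    norm-conj = solve-∀ ℚ-ring
    pzˢ : Positive zˢ
    pzˢ = inj₂ (0<b , subst (_< 0ℚ) (norm-conj a b Dq) N<0)

  private
    neg-sub : ∀ x y → - (x - y) ≡ y - x
    neg-sub = solve-∀ ℚ-ring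

    drop-zero : ∀ y D → 0ℚ * 0ℚ - y * D ≡ - (y * D)
    drop-zero = solve-∀ ℚ-ring

    drop-zero′ : ∀ x D → x - 0ℚ * 0ℚ * D ≡ x
    drop-zero′ = solve-∀ ℚ-ring

    norm-pos : ∀ a b → b * b * Dq < a * a → 0ℚ < norm (a ⊕ b √)
    norm-pos a b h = <⇒0<- h

    norm-neg : ∀ a b → a * a < b * b * Dq → norm (a ⊕ b √) < 0ℚ
    norm-neg a b h = neg-neg (subst (0ℚ <_) (sym (neg-sub (a * a) (b * b * Dq))) (<⇒0<- h))

  -- `PosF` distinguishes the signs of both coefficients, `Positive` the sign of the norm, which
  -- behaves well under products. A nonzero norm selects the coefficient that must be positive.
  PosF⇒Positive : ∀ {z} → PosF z → Positive z
  PosF⇒Positive {z@(a ⊕ b √)} (inj₁ (0<a , 0≤b)) with ℚ.<-cmp (norm z) 0ℚ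
  ... | tri> _ _ 0<N = inj₁ (0<a , 0<N)
  ... | tri≈ _ h _ = ⊥-elim (ℚ.<-irrefl (sym (cong re (norm≡0⇒≡0 z h))) 0<a)
  ... | tri< N<0 _ _ with ℚ.<-cmp 0ℚ b
  ...   | tri< 0<b _ _ = inj₂ (0<b , N<0)
  ...   | tri≈ _ refl _ = ⊥-elim (ℚ.<-asym N<0 (subst (0ℚ <_) (sym (drop-zero′ (a * a) Dq)) (*-pos 0<a 0<a)))
  ...   | tri> _ _ b<0 = ⊥-elim (ℚ.<-irrefl refl (ℚ.<-≤-trans b<0 0≤b))
  PosF⇒Positive {z@(a ⊕ b √)} (inj₂ (inj₁ (0≤a , 0<b))) with ℚ.<-cmp (norm z) 0ℚ
  ... | tri< N<0 _ _ = inj₂ (0<b , N<0)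
  ... | tri≈ _ h _ = ⊥-elim (ℚ.<-irrefl (sym (cong im (norm≡0⇒≡0 z h))) 0<b)
  ... | tri> _ _ 0<N with ℚ.<-cmp 0ℚ a
  ...   | tri< 0<a _ _ = inj₁ (0<a , 0<N)
  ...   | tri≈ _ refl _ = ⊥-elim (ℚ.<-asym 0<N (neg-neg (subst (0ℚ <_)
            (trans (sym (neg-involutive (b * b * Dq))) (cong -_ (sym (drop-zero (b * b) Dq)))) (*-pos (*-pos 0<b 0<b) 0<Dq))))
  ...   | tri> _ _ a<0 = ⊥-elim (ℚ.<-irrefl refl (ℚ.<-≤-trans a<0 0≤a))
  PosF⇒Positive {a ⊕ b √} (inj₂ (inj₂ (inj₁ (0<a , _ , h)))) = inj₁ (0<a , norm-pos a b h)
  PosF⇒Positive {a ⊕ b √} (inj₂ (inj₂ (inj₂ (_ , 0<b , h)))) = inj₂ (0<b , norm-neg a b h)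

  Positive⇒PosF : ∀ {z} → Positive z → PosF z
  Positive⇒PosF {a ⊕ b √} (inj₁ (0<a , 0<N)) with b ℚ.<? 0ℚ
  ... | yes b<0 = inj₂ (inj₂ (inj₁ (0<a , b<0 , 0<-⇒< 0<N)))
  ... | no ¬b<0 = inj₁ (0<a , ℚ.≮⇒≥ ¬b<0)
  Positive⇒PosF {a ⊕ b √} (inj₂ (0<b , N<0)) with a ℚ.<? 0ℚ
  ... | yes a<0 = inj₂ (inj₂ (inj₂ (a<0 , 0<b , 0<-⇒< (subst (0ℚ <_) (neg-sub (a * a) (b * b * Dq)) (neg-pos N<0)))))
  ... | no ¬a<0 = inj₂ (inj₁ (ℚ.≮⇒≥ ¬a<0 , 0<b))

  PosF-+ : ∀ {x y} → PosF x → PosF y → PosF (x +F y)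
  PosF-+ {x} {y} hx hy = Positive⇒PosF (Positive-+ x y (PosF⇒Positive hx) (PosF⇒Positive hy))

  PosF-* : ∀ {x y} → PosF x → PosF y → PosF (x *F y)
  PosF-* {x} {y} hx hy = Positive⇒PosF (Positive-* x y (PosF⇒Positive hx) (PosF⇒Positive hy))

  PosF-cmp : ∀ x → PosF x ⊎ x ≡ 0F ⊎ PosF (-F x)
  PosF-cmp x = Sum.map Positive⇒PosF (Sum.map₂ Positive⇒PosF) (Positive-cmp x)

  ¬PosF-0 : ¬ PosF 0F
  ¬PosF-0 h = ¬Positive-0 (PosF⇒Positive h)

  PosF-ι : ∀ {x} → 0ℚ < x → PosF (ι x)
  PosF-ι 0<x = inj₁ (0<x , ℚ.≤-refl)

  conj-* : ∀ x y → conj (x *F y) ≡ conj x *F conj y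
  conj-* (a ⊕ b √) (c ⊕ d √) = cong₂ _⊕_√ (conj₁ a b c d Dq) (conj₂ a b c d)
    where
    conj₁ : ∀ a b c d D → a * c + b * d * D ≡ a * c + (- b) * (- d) * D
    conj₁ = solve-∀ ℚ-ring
    conj₂ : ∀ a b c d → - (a * d + b * c) ≡ a * (- d) + (- b) * c
    conj₂ = solve-∀ ℚ-ring

  invF-inverse : ∀ z → z ≢ 0F → z *F invF z ≡ 1F
  invF-inverse z@(a ⊕ b √) z≢0 with a * a - b * b * Dq ℚ.≟ 0ℚ
  ... | yes h  = ⊥-elim (z≢0 (norm≡0⇒≡0 z h))
  ... | no N≢0 = cong₂ _⊕_√
      (trans (inv₁ a b n Dq) (ℚ.*-inverseʳ (norm z) {{ℚ.≢-nonZero N≢0}}))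
      (inv₂ a b n)
    where
    n : ℚ
    n = (ℚ.1/ norm z) {{ℚ.≢-nonZero N≢0}}
    inv₁ : ∀ a b n D → a * (a * n) + b * ((- b) * n) * D ≡ (a * a - b * b * D) * n
    inv₁ = solve-∀ ℚ-ring
    inv₂ : ∀ a b n → a * ((- b) * n) + b * (a * n) ≡ 0ℚ
    inv₂ = solve-∀ ℚ-ring

  ιℤ-* : ∀ m n → ιℤ (m ℤ.* n) ≡ ιℤ m *F ιℤ n
  ιℤ-* m n = cong₂ _⊕_√ (trans (/1-* m n) (mul₁ (m ℚ./ 1) (n ℚ./ 1) Dq)) (mul₂ (m ℚ./ 1) (n ℚ./ 1))
    where
    mul₁ : ∀ x y D → x * y ≡ x * y + 0ℚ * 0ℚ * D
    mul₁ = solve-∀ ℚ-ring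
    mul₂ : ∀ x y → 0ℚ ≡ x * 0ℚ + 0ℚ * y
    mul₂ = solve-∀ ℚ-ring

  -- The conjugate of β, and the instance of the axioms

  module Conjugates (p q : ℤ) (discriminant : p ℤ.* p ℤ.+ ℤ.+ 4 ℤ.* q ≡ ℤ.+ D) where

    γ : QF
    γ = -F conj (β p)

    -- This is -ββ′ = (D - p²)/4.
    β*γ : β p *F γ ≡ ιℤ q
    β*γ = cong₂ _⊕_√
      (trans (cong₂ (λ v w → v * - v + ½ * ½ * w) (/2 p) Dq≡) (product₁ (p ℚ./ 1) (q ℚ./ 1)))
      (product₂ (p ℚ./ 2))
      where
      Dq≡ : Dq ≡ (p ℚ./ 1) * (p ℚ./ 1) + ((ℤ.+ 4) ℚ./ 1) * (q ℚ./ 1)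
      Dq≡ = trans (cong (ℚ._/ 1) (sym discriminant)) (trans (/1-+ (p ℤ.* p) (ℤ.+ 4 ℤ.* q)) (cong₂ _+_ (/1-* p p) (/1-* (ℤ.+ 4) q)))
      product₁ : ∀ x y → (x * ½) * - (x * ½) + ½ * ½ * (x * x + ((ℤ.+ 4) ℚ./ 1) * y) ≡ y
      product₁ = solve-∀ ℚ-ring
      product₂ : ∀ x → x * ½ + ½ * - x ≡ 0ℚ
      product₂ = solve-∀ ℚ-ring

    ιℤ-p : ιℤ p ≡ β p -F γ
    ιℤ-p = cong₂ _⊕_√ (trans (halves (p ℚ./ 1)) (cong (λ v → v - - v) (sym (/2 p)))) refl
      where
      halves : ∀ x → x ≡ x * ½ - - (x * ½)
      halves = solve-∀ ℚ-ring

    conj-β : conj (β p) ≡ -F γ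
    conj-β = cong₂ _⊕_√ (sym (neg-involutive (p ℚ./ 2))) refl

    PosF-γ : β' p <F ι 0ℚ → PosF γ
    PosF-γ = subst PosF (cong₂ _⊕_√ (ℚ.+-identityˡ _) refl)

    PosF-1-γ : (-F 1F) <F β' p → PosF (1F -F γ)
    PosF-1-γ = subst PosF (cong₂ _⊕_√ (shift (p ℚ./ 2)) refl)
      where
      shift : ∀ x → x - (- 1ℚ) ≡ 1ℚ - (- x)
      shift = solve-∀ ℚ-ring

    PosF-β : 1F <F β p → PosF (β p)
    PosF-β h = subst PosF (cong₂ _⊕_√ (sub-add 1ℚ (p ℚ./ 2)) refl) (PosF-+ h (PosF-ι {1ℚ} (ℚ.positive⁻¹ 1ℚ)))

  orderedQuadraticRing : (p : ℤ) → p ℤ.* p ℤ.+ ℤ.+ 4 ℤ.* 1ℤ ≡ ℤ.+ D →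
                         1F <F β p → β' p <F ι 0ℚ → (-F 1F) <F β' p → OrderedQuadraticRing
  orderedQuadraticRing p discriminant 1<β β'<0 -1<β' = record
    { K = QF ; _+_ = _+F_ ; _*_ = _*F_ ; -_ = -F_ ; ι = ιℤ
    ; isCommutativeRing = QF-isCommutativeRing
    ; ι-+ = λ m n → cong (_⊕ 0ℚ √) (/1-+ m n)
    ; ι-* = ιℤ-*
    ; ι-neg = λ n → cong (_⊕ 0ℚ √) (/1-neg n)
    ; Pos = PosF
    ; Pos-1 = PosF-1
    ; Pos-+ = PosF-+
    ; Pos-* = PosF-*
    ; Pos-cmp = PosF-cmp
    ; ¬Pos-0 = ¬PosF-0
    ; conj = conj
    ; conj-+ = λ x y → cong ((re x + re y) ⊕_√) (ℚ.neg-distrib-+ (im x) (im y))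
    ; conj-* = conj-*
    ; conj-neg = λ _ → refl
    ; conj-involutive = λ x → cong (re x ⊕_√) (neg-involutive (im x))
    ; conj-ι = λ _ → refl
    ; β = β p ; γ = γ ; u = invF (β p +F 1F) ; p = p
    ; conj-β = conj-β
    ; ι-p = ιℤ-p
    ; βγ≡1 = β*γ
    ; u-inv = invF-inverse (β p +F 1F) (λ eq → ¬PosF-0 (subst PosF eq (PosF-+ (PosF-β 1<β) PosF-1)))
    ; Pos-γ = PosF-γ β'<0
    ; Pos-1-γ = PosF-1-γ -1<β'
    }
    where
    open Conjugates p 1ℤ discriminant
    PosF-1 : PosF 1F
    PosF-1 = PosF-ι {1ℚ} (ℚ.positive⁻¹ 1ℚ)

  -- ββ′ = -q, and β > 0 > β′.
  negative-conjugate⇒q≢-1 : ∀ p → p ℤ.* p ℤ.+ ℤ.+ 4 ℤ.* ℤ.- 1ℤ ≡ ℤ.+ D → 1F <F β p → ¬ (β' p <F ι 0ℚ)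
  negative-conjugate⇒q≢-1 p discriminant 1<β β'<0 =
    ¬PosF-0 (PosF-+ (subst PosF β*γ (PosF-* (PosF-β 1<β) (PosF-γ β'<0))) (PosF-ι {1ℚ} (ℚ.positive⁻¹ 1ℚ)))
    where open Conjugates p (ℤ.- 1ℤ) discriminant

  ιℤ-fraction : ∀ x → ιℤ (ℚ.↧ x) *F ι x ≡ ιℤ (ℚ.↥ x)
  ιℤ-fraction x = cong₂ _⊕_√
    (trans (cong₂ _+_ (denominator-clears x) (ℚ.*-zeroˡ Dq)) (ℚ.+-identityʳ _))
    (trans (cong₂ _+_ (ℚ.*-zeroʳ (ℚ.↧ x ℚ./ 1)) (ℚ.*-zeroˡ x)) refl)

  PosF-denominator : ∀ x → PosF (ιℤ (ℚ.↧ x))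
  PosF-denominator x = PosF-ι (ℚ.positive⁻¹ (ℚ.↧ x ℚ./ 1) {{ℚ.normalize-pos (ℚ.↧ₙ x) 1}})

-- Conclusion for rational points

open import Data.Nat using (ℕ; _*_)
open import Data.Integer using (ℤ; +_; -_; _+_)
open import Data.Rational using (ℚ; 0ℚ; _≤_; _<_)

theorem7 : (p q : ℤ) (D : ℕ)
    → (p Data.Integer.* p) + (+ 4 Data.Integer.* q) ≡ + D
    → (∀ m → m * m ≢ D)
    → Field._<F_ D (Field.1F D) (Field.β D p)
    → Field._<F_ D (Field.β' D p) (Field.ι D 0ℚ)
    → Field._<F_ D (Field.-F_ D (Field.1F D)) (Field.β' D p)
    → (q ≡ + 1 ⊎ q ≡ - (+ 1))
    → ((x : ℚ) → Field.InI D p (Field.ι D x) → x ≤ 0ℚ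
    → Field.HasPurelyPeriodicExpansion D p (Field.ι D x))
    × ((x : ℚ) → Field.InI D p (Field.ι D x) → 0ℚ < x
    → ¬ Field.HasPurelyPeriodicExpansion D p (Field.ι D x))
theorem7 p q D discriminant nonsquare 1<β β'<0 -1<β' (inj₂ refl) =
  ⊥-elim (QuadraticOrder.negative-conjugate⇒q≢-1 D nonsquare p discriminant 1<β β'<0)
theorem7 p q D discriminant nonsquare 1<β β'<0 -1<β' (inj₁ refl) =
    (λ x x∈I x≤0 → R.nonPositive⇒purelyPeriodic x x∈I (neg-ι x x≤0))
  , (λ x x∈I 0<x → R.positive⇒¬purelyPeriodic x x∈I (PosF-ι 0<x))
  where
  open Field D using (ι; -F_; PosF; InI)
  open QuadraticOrder D nonsquare

  open Dynamics (orderedQuadraticRing p discriminant 1<β β'<0 -1<β') using (NonNeg; module Rational)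

  -- Self-conjugacy is `refl` because `- 0ℚ` computes to `0ℚ`; the lattice denominator is that of x
  -- in lowest terms.
  module R (x : ℚ) (x∈I : InI p (ι x)) = Rational {ι x} {ℚ.↧ x} {ℚ.↥ x} refl (PosF-denominator x) (ιℤ-fraction x) x∈I

  neg-ι : ∀ x → x ≤ 0ℚ → NonNeg (-F ι x)
  neg-ι x x≤0 with ℚ.<-cmp x 0ℚ
  ... | tri< x<0 _ _  = inj₁ (PosF-ι (neg-pos x<0))
  ... | tri≈ _ refl _ = inj₂ refl
  ... | tri> _ _ 0<x  = ⊥-elim (ℚ.<-irrefl refl (ℚ.<-≤-trans 0<x x≤0))
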